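{- There exists a separable metrizable space $X$ such that every analytic subset of $X$ is either countable or contains a copy of $2^\omega$, but some uncountable coanalytic subset of $X$ contains no copy of $2^\omega$.
   Context: Spaces are not necessarily Polish. A subset $A$ of a space $X$ is an analytic (respectively coanalytic) subset of $X$ if there is a Polish space $T$ containing $X$ as a subspace and an analytic, i.e. $\mathbf{\Sigma}^1_1$ (respectively coanalytic, i.e. $\mathbf{\Pi}^1_1$) subset $B$ of $T$ with $A=B\cap X$. A copy of $2^\omega$ is a subspace homeomorphic to the Cantor space $2^\omega$. The result is a theorem of $\mathsf{ZFC}$. -}

module Defs where

open import Axiom.ExcludedMiddle public using (ExcludedMiddle)
open import Axiom.Extensionality.Propositional public using (Extensionality)
open import Data.Bool.Base using (Bool)
open import Data.Nat.Base as ℕ using (ℕ; _⊔_)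
import Data.Nat.Properties as ℕ
open import Data.Product.Base using (Σ; ∃; ∃-syntax; _×_; _,_; proj₁; proj₂)
open import Data.Rational.Base as ℚ using (ℚ; 0ℚ; 1ℚ)
import Data.Rational.Properties as ℚ
open import Data.Refinement using (Refinement; value)
open import Data.Unit.Polymorphic.Base using (⊤)
open import Function.Bundles using (_↔_; _⇔_; Inverse)
open import Function.Metric.Structures using (IsGeneralMetric)
open import Level using (0ℓ) renaming (suc to lsuc)
open import Relation.Binary.PropositionalEquality
  using (_≡_; refl; sym; trans; cong; subst)
open import Relation.Binary.Definitions using (tri<; tri≈; tri>)
open import Relation.Nullary using (¬_; contradiction)
open import Relation.Unary
  using (Pred; _∈_; _∉_; _⊆_; _≐_; _∩_; ∁; ⋃; U; _⊢_; Satisfiable)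

private
  1ℓ = lsuc 0ℓ

-- The metatheory is classical.  Under ExcludedMiddle and Extensionality, a type
-- in Set behaves as a set of ZFC; in particular ExcludedMiddle, being stated
-- for arbitrary types P : Set ℓ and not only for propositions, yields ¬ ¬ P → P
-- and hence a choice function for any family of nonempty types.

-- Reals as lower Dedekind cuts; classically these agree with two-sided cuts.
record ℝ : Set₁ where
  field
    lower       : Pred ℚ 0ℓ
    inhabited   : ∃[ q ] q ∈ lower
    bounded     : ∃[ q ] q ∉ lower
    down-closed : ∀ {p q} → p ℚ.< q → q ∈ lower → p ∈ lower
    no-maximum  : ∀ {p} → p ∈ lower → ∃[ q ] p ℚ.< q × q ∈ lower

open ℝ

infix 4 _≈ℝ_ _≤ℝ_ _<ℝ_

_≈ℝ_ : ℝ → ℝ → Set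
x ≈ℝ y = lower x ≐ lower y

_≤ℝ_ : ℝ → ℝ → Set
x ≤ℝ y = lower x ⊆ lower y

_<ℝ_ : ℝ → ℝ → Set
x <ℝ y = ∃[ q ] q ∉ lower x × q ∈ lower y

0ℝ : ℝ
0ℝ = record
  { lower       = ℚ._< 0ℚ
  ; inhabited   = ℚ.- 1ℚ , ℚ.negative⁻¹ (ℚ.- 1ℚ)
  ; bounded     = 0ℚ , ℚ.<-irrefl refl
  ; down-closed = ℚ.<-trans
  ; no-maximum  = ℚ.<-dense
  }

infixl 6 _+ℝ_

_+ℝ_ : ℝ → ℝ → ℝ
x +ℝ y = record
  { lower       = Sum
  ; inhabited   = let r , r∈x = inhabited x
                      s , s∈y = inhabited y
                  in r ℚ.+ s , r , s , r∈x , s∈y , refl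
  ; bounded     = let a , a∉x = bounded x
                      b , b∉y = bounded y
                  in a ℚ.+ b , λ (r , s , r∈x , s∈y , eq) →
                       ℚ.<-irrefl (sym eq) (ℚ.+-mono-< (below x a∉x r∈x) (below y b∉y s∈y))
  ; down-closed = λ { {p} p<q (r , s , r∈x , s∈y , refl) →
                      p ℚ.- s , s , down-closed x (shift p<q) r∈x , s∈y , sym (-+-cancel p s) }
  ; no-maximum  = λ { (r , s , r∈x , s∈y , refl) →
                      let r′ , r<r′ , r′∈x = no-maximum x r∈x
                      in r′ ℚ.+ s , ℚ.+-monoˡ-< s r<r′ , r′ , s , r′∈x , s∈y , refl }
  }
  where
  Sum : Pred ℚ 0ℓ
  Sum q = ∃[ r ] ∃[ s ] r ∈ lower x × s ∈ lower y × q ≡ r ℚ.+ s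

  below : ∀ z {a r} → a ∉ lower z → r ∈ lower z → r ℚ.< a
  below z {a} {r} a∉z r∈z with ℚ.<-cmp r a
  ... | tri< r<a _ _    = r<a
  ... | tri≈ _ refl _   = contradiction r∈z a∉z
  ... | tri> _ _ a<r    = contradiction (down-closed z a<r r∈z) a∉z

  -+-cancel : ∀ p s → (p ℚ.- s) ℚ.+ s ≡ p
  -+-cancel p s = trans (ℚ.+-assoc p (ℚ.- s) s)
    (trans (cong (p ℚ.+_) (ℚ.+-inverseˡ s)) (ℚ.+-identityʳ p))

  +-cancel : ∀ r s → (r ℚ.+ s) ℚ.- s ≡ r
  +-cancel r s = trans (ℚ.+-assoc r s (ℚ.- s))
    (trans (cong (r ℚ.+_) (ℚ.+-inverseʳ s)) (ℚ.+-identityʳ r))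

  shift : ∀ {p r s} → p ℚ.< r ℚ.+ s → p ℚ.- s ℚ.< r
  shift {p} {r} {s} p<r+s =
    subst (p ℚ.- s ℚ.<_) (+-cancel r s) (ℚ.+-monoˡ-< (ℚ.- s) p<r+s)

-- Openness of ∅ is the case of the union over the empty type.

record Space : Set₂ where
  field
    Carrier : Set
    Open    : Pred (Pred Carrier 0ℓ) 1ℓ
    Open-≐  : ∀ {V W} → V ≐ W → Open V → Open W
    Open-U  : Open U
    Open-∩  : ∀ {V W} → Open V → Open W → Open (V ∩ W)
    Open-⋃  : ∀ {I : Set} {V : I → Pred Carrier 0ℓ} →
              (∀ i → Open (V i)) → Open (⋃ I V)

open Space public using (Carrier; Open)
open Space

Subset : Space → Set₁
Subset X = Pred (Carrier X) 0ℓ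

Discrete : Set → Space
Discrete A = record
  { Carrier = A
  ; Open    = λ _ → ⊤
  }

Countable-product : (ℕ → Space) → Space
Countable-product X = record
  { Carrier = ∀ i → Carrier (X i)
  ; Open    = ΠOpen
  ; Open-≐  = λ (V⊆W , W⊆V) oV x x∈W →
      let n , B , oB , x∈B , B⊆V = oV x (W⊆V x∈W)
      in n , B , oB , x∈B , λ y y∈B → V⊆W (B⊆V y y∈B)
  ; Open-U  = λ x _ → 0 , (λ _ → U) , (λ i → Open-U (X i)) , _ , _
  ; Open-∩  = λ oV oW x (x∈V , x∈W) →
      let m , B , oB , x∈B , B⊆V = oV x x∈V
          n , C , oC , x∈C , C⊆W = oW x x∈W
      in m ⊔ n , (λ i → B i ∩ C i) , (λ i → Open-∩ (X i) (oB i) (oC i))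
       , (λ i → x∈B i , x∈C i)
       , λ y y∈ → B⊆V y (λ i i<m → proj₁ (y∈ i (ℕ.m<n⇒m<n⊔o n i<m)))
                , C⊆W y (λ i i<n → proj₂ (y∈ i (ℕ.m<n⇒m<o⊔n m i<n)))
  ; Open-⋃  = λ oV x (i , x∈Vi) →
      let n , B , oB , x∈B , B⊆Vi = oV i x x∈Vi
      in n , B , oB , x∈B , λ y y∈B → i , B⊆Vi y y∈B
  }
  where
  -- Each point of V lies in a basic box inside V; only the factors B i with
  -- i < n are constrained.
  ΠOpen : Pred (Pred (∀ i → Carrier (X i)) 0ℓ) 1ℓ
  ΠOpen V = ∀ x → x ∈ V →
    ∃[ n ] Σ (∀ i → Subset (X i)) λ B →
      (∀ i → Open (X i) (B i)) × (∀ i → x i ∈ B i) ×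
      (∀ y → (∀ i → i ℕ.< n → y i ∈ B i) → y ∈ V)

2^ω : Space
2^ω = Countable-product λ _ → Discrete Bool

-- Points of a subspace carry their membership proof irrelevantly, so that they
-- are determined by the underlying point of X.
Subspace : (X : Space) → Subset X → Space
Subspace X A = record
  { Carrier = Refinement (Carrier X) A
  ; Open    = λ V → ∃[ W ] Open X W × V ≐ value ⊢ W
  ; Open-≐  = λ (V⊆V′ , V′⊆V) (W , oW , V⊆W , W⊆V) →
      W , oW , (λ v → V⊆W (V′⊆V v)) , (λ w → V⊆V′ (W⊆V w))
  ; Open-U  = U , Open-U X , _ , _
  ; Open-∩  = λ (W , oW , V⊆W , W⊆V) (W′ , oW′ , V′⊆W′ , W′⊆V′) →
      W ∩ W′ , Open-∩ X oW oW′
      , (λ (v , v′) → V⊆W v , V′⊆W′ v′) , (λ (w , w′) → W⊆V w , W′⊆V′ w′)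
  ; Open-⋃  = λ {I} oV →
      ⋃ I (λ i → proj₁ (oV i)) , Open-⋃ X (λ i → proj₁ (proj₂ (oV i)))
      , (λ (i , v) → i , proj₁ (proj₂ (proj₂ (oV i))) v)
      , (λ (i , w) → i , proj₂ (proj₂ (proj₂ (oV i))) w)
  }

Continuous : (X Y : Space) → (Carrier X → Carrier Y) → Set₁
Continuous X Y f = ∀ V → Open Y V → Open X (f ⊢ V)

infix 4 _≅_

record _≅_ (X Y : Space) : Set₁ where
  field
    bijection       : Carrier X ↔ Carrier Y
    to-continuous   : Continuous X Y (Inverse.to bijection)
    from-continuous : Continuous Y X (Inverse.from bijection)

  open Inverse bijection public using (to; from)

-- Countable subsets may be finite or empty.
Countable : ∀ {A : Set} → Pred A 0ℓ → Set
Countable {A} P =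
  Σ (A → ℕ) λ f → ∀ {x y} → x ∈ P → y ∈ P → f x ≡ f y → x ≡ y

Dense : (X : Space) → Subset X → Set₁
Dense X D = ∀ V → Open X V → Satisfiable V → Satisfiable (D ∩ V)

Separable : Space → Set₁
Separable X = ∃[ D ] Countable D × Dense X D

IsMetric : ∀ {A : Set} → (A → A → ℝ) → Set₁
IsMetric = IsGeneralMetric _≡_ _≈ℝ_ _≤ℝ_ 0ℝ _+ℝ_

Ball : ∀ {A : Set} → (A → A → ℝ) → A → ℝ → Pred A 0ℓ
Ball d x ε y = d x y <ℝ ε

Induces : (X : Space) → (Carrier X → Carrier X → ℝ) → Set₁
Induces X d = ∀ V →
  Open X V ⇔ (∀ x → x ∈ V → ∃[ ε ] 0ℝ <ℝ ε × Ball d x ε ⊆ V)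

Cauchy : ∀ {A : Set} → (A → A → ℝ) → (ℕ → A) → Set₁
Cauchy d s = ∀ ε → 0ℝ <ℝ ε →
  ∃[ N ] ∀ m n → N ℕ.≤ m → N ℕ.≤ n → d (s m) (s n) <ℝ ε

Converges : ∀ {A : Set} → (A → A → ℝ) → (ℕ → A) → A → Set₁
Converges d s x = ∀ ε → 0ℝ <ℝ ε → ∃[ N ] ∀ n → N ℕ.≤ n → d (s n) x <ℝ ε

Complete : ∀ {A : Set} → (A → A → ℝ) → Set₁
Complete d = ∀ s → Cauchy d s → ∃[ x ] Converges d s x

Metrizable : Space → Set₁
Metrizable X = ∃[ d ] IsMetric d × Induces X d

CompletelyMetrizable : Space → Set₁
CompletelyMetrizable X = ∃[ d ] IsMetric d × Induces X d × Complete d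

Polish : Space → Set₁
Polish X = Separable X × CompletelyMetrizable X

-- Σ¹₁ subsets of a Polish space T: continuous images of Polish spaces (the
-- empty space is Polish, so ∅ is included).
Σ¹₁ : (T : Space) → Subset T → Set₂
Σ¹₁ T B = Σ Space λ P → Polish P ×
  Σ (Carrier P → Carrier T) λ f →
    Continuous P T f × B ≐ (λ t → ∃[ p ] f p ≡ t)

Π¹₁ : (T : Space) → Subset T → Set₂
Π¹₁ T B = Σ¹₁ T (∁ B)

-- A is the trace on X of a set B in the class Γ of some Polish space T that
-- contains X as a subspace, i.e. with an identification h of X with Y ⊆ T.
Trace : (∀ T → Subset T → Set₂) → (X : Space) → Subset X → Set₂
Trace Γ X A =
  Σ Space λ T → Polish T ×
  Σ (Subset T) λ Y → Σ (X ≅ Subspace T Y) λ h →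
  Σ (Subset T) λ B → Γ T B × A ≐ (λ x → value (_≅_.to h x) ∈ B)

Analytic : (X : Space) → Subset X → Set₂
Analytic = Trace Σ¹₁

Coanalytic : (X : Space) → Subset X → Set₂
Coanalytic = Trace Π¹₁

ContainsCopyOf2^ω : (X : Space) → Subset X → Set₁
ContainsCopyOf2^ω X A = Σ (Subset X) λ K → K ⊆ A × Subspace X K ≅ 2^ω

{-# OPTIONS --safe #-}
-- Let D be the analytic set of ill-founded trees on ω, coded in 2^ω, and let S
-- contain one well-founded tree of each countable rank.  Take X = D ∪ S and
-- C = S = X ∖ D.  By the boundedness theorem an analytic set disjoint from D
-- contains trees of boundedly many ranks only, so it meets S in a countable set;
-- in particular the uncountable coanalytic set C contains no copy of 2^ω.  If A
-- is analytic and A ∩ D is uncountable, then A ∩ D contains a copy of 2^ω by the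
-- perfect set theorem.  If A ∩ D is countable, then A ∖ (A ∩ D) is analytic and
-- disjoint from D, so A ∩ S is countable as well.

module Submission where

open import Defs
open import Data.Bool.Base using (Bool; true; false; not; if_then_else_; _∨_)
import Data.Bool.Properties as Bool
open import Data.Empty using (⊥)
import Data.Integer.Base as ℤ
import Data.Integer.Properties as ℤ
open import Data.Irrelevant using ([_])
open import Data.List.Base as List using (List; []; _∷_; applyDownFrom; length; drop)
import Data.List.Properties as List
open import Data.Maybe.Base as Maybe using (Maybe; just; nothing; is-just)
open import Data.Nat.Base as ℕ using (ℕ; zero; suc; _+_; _⊔_; _≤_; _<_; z≤n; s≤s)
open import Data.Nat.Binary.Base using (ℕᵇ; zero; 2[1+_]; 1+[2_]; toℕ; fromℕ)
open import Data.Nat.Binary.Properties using (fromℕ-toℕ)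
open import Data.Nat.Coprimality using (1-coprimeTo)
import Data.Nat.Properties as ℕ
open import Data.Product.Base using (Σ; ∃; ∃-syntax; _×_; _,_; proj₁; proj₂)
open import Data.Rational.Base as ℚ using (ℚ; mkℚ; 0ℚ; 1ℚ)
import Data.Rational.Properties as ℚ
open import Data.Refinement using (Refinement; value; value-injective; _,_)
open import Data.Sum.Base using (_⊎_; inj₁; inj₂; [_,_]′)
open import Data.Unit.Base using (⊤; tt)
open import Function.Base using (_∘_; id)
open import Function.Bundles using (_↣_; mk↣; Injection; mk⇔; Equivalence; mk↔ₛ′; Inverse)
open import Function.Metric.Structures using (module IsGeneralMetric)
open import Induction.WellFounded using (Acc; acc)
open import Level using (0ℓ)
open import Relation.Binary.Definitions using (tri<; tri≈; tri>)
open import Relation.Binary.PropositionalEquality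
  using (_≡_; _≢_; refl; sym; trans; cong; cong₂; cong-app; subst; subst₂; isEquivalence)
open import Relation.Binary.Structures using (IsPartialOrder)
open import Relation.Nullary using (¬_; Dec; yes; no; contradiction)
open import Relation.Nullary.Decidable using (decidable-stable; isYes; does; recompute; dec-true)
open import Relation.Unary using (Pred; _∈_; _∉_; _⊆_; _≐_; _∩_; _∪_; ∁; ⋃; _⊢_)

-- Thinning to `S` is what turns a bound on ranks into countability, since uncountably many trees
-- share a single rank. Brouwer trees name each ordinal in many ways, so the choice is made on
-- `≃`-classes. The analytic sets of the statement are images of arbitrary Polish spaces inside
-- arbitrary Polish spaces. They are brought into `2^ω` in the form `Souslin`, as letterwise images
-- of closed sets of sequences over a countable alphabet; there the perfect set theorem and
-- boundedness are combinatorics of initial segments. A copy of `2^ω` in `C` is excluded because its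
-- range is itself of this form and disjoint from `D`, hence countable. As `D` is not Borel,
-- removing it from `A` need not leave an analytic set. It does when `A ∩ D` is countable: a
-- sequence can then record, for each point removed, a coordinate at which it is avoided.

Agree : {A : Set} → ℕ → (x y : ℕ → A) → Set
Agree n x y = ∀ i → i < n → x i ≡ y i

module _ {A : Set} where

  Agree-sym : ∀ {n} {x y : ℕ → A} → Agree n x y → Agree n y x
  Agree-sym p i i<n = sym (p i i<n)

  Agree-trans : ∀ {n} {x y z : ℕ → A} → Agree n x y → Agree n y z → Agree n x z
  Agree-trans p q i i<n = trans (p i i<n) (q i i<n)

  Agree-≤ : ∀ {m n} {x y : ℕ → A} → m ≤ n → Agree n x y → Agree m x y
  Agree-≤ m≤n p i i<m = p i (ℕ.<-≤-trans i<m m≤n)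

  Agree-suc : ∀ {n} {x y : ℕ → A} → Agree n x y → x n ≡ y n → Agree (suc n) x y
  Agree-suc {n} p q i i<1+n with ℕ.m≤n⇒m<n∨m≡n (ℕ.s≤s⁻¹ i<1+n)
  ... | inj₁ i<n  = p i i<n
  ... | inj₂ refl = q

  Agree-cong : {B : Set} {x y : ℕ → A} (f : A → B) → ∀ {n} → Agree n x y → Agree n (f ∘ x) (f ∘ y)
  Agree-cong f p i i<n = cong f (p i i<n)

  prefix-cong : {x y : ℕ → A} → ∀ {n} → Agree n x y → applyDownFrom x n ≡ applyDownFrom y n
  prefix-cong {n = zero}  p = refl
  prefix-cong {n = suc n} p =
    cong₂ _∷_ (p n ℕ.≤-refl) (prefix-cong (Agree-≤ (ℕ.n≤1+n n) p))

  prefix-injective : {x y : ℕ → A} → ∀ m n →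
    applyDownFrom x m ≡ applyDownFrom y n → m ≡ n × Agree m x y
  prefix-injective zero    zero    eq = refl , λ _ ()
  prefix-injective (suc m) (suc n) eq
    with refl , p ← prefix-injective m n (List.∷-injectiveʳ eq) =
    refl , Agree-suc p (List.∷-injectiveˡ eq)

  drop-prefix : (x : ℕ → A) → ∀ k n → drop k (applyDownFrom x (k + n)) ≡ applyDownFrom x n
  drop-prefix x zero    n = refl
  drop-prefix x (suc k) n = drop-prefix x k n

-- Numbering finite sequences.

-- Lists are written in unary: a term `n` becomes `n` digits `2[1+_]` closed by one digit `1+[2_]`.
shift : ℕ → ℕᵇ → ℕᵇ
shift zero    b = 1+[2 b ]
shift (suc n) b = 2[1+ shift n b ]

toBinary : List ℕ → ℕᵇ
toBinary []      = zero
toBinary (n ∷ l) = shift n (toBinary l)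

bump : List ℕ → List ℕ
bump []      = []
bump (n ∷ l) = suc n ∷ l

fromBinary : ℕᵇ → List ℕ
fromBinary zero     = []
fromBinary 2[1+ b ] = bump (fromBinary b)
fromBinary 1+[2 b ] = 0 ∷ fromBinary b

fromBinary-shift : ∀ n b → fromBinary (shift n b) ≡ n ∷ fromBinary b
fromBinary-shift zero    b = refl
fromBinary-shift (suc n) b = cong bump (fromBinary-shift n b)

fromBinary-toBinary : ∀ l → fromBinary (toBinary l) ≡ l
fromBinary-toBinary []      = refl
fromBinary-toBinary (n ∷ l) =
  trans (fromBinary-shift n (toBinary l)) (cong (n ∷_) (fromBinary-toBinary l))

abstract

  code : List ℕ → ℕ
  code l = toℕ (toBinary l)

  decode : ℕ → List ℕ
  decode n = fromBinary (fromℕ n)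

  decode-code : ∀ l → decode (code l) ≡ l
  decode-code l = trans (cong fromBinary (fromℕ-toℕ (toBinary l))) (fromBinary-toBinary l)

code-injective : ∀ {l l′} → code l ≡ code l′ → l ≡ l′
code-injective {l} {l′} eq =
  trans (sym (decode-code l)) (trans (cong decode eq) (decode-code l′))

ℕ↣ℕ : ℕ ↣ ℕ
ℕ↣ℕ = mk↣ {to = id} id

Bool↣ℕ : Bool ↣ ℕ
Bool↣ℕ = mk↣ injective
  where
  injective : ∀ {b c} → (if b then 1 else 0) ≡ (if c then 1 else 0) → b ≡ c
  injective {false} {false} _ = refl
  injective {true}  {true}  _ = refl

List↣ℕ : {A : Set} → A ↣ ℕ → List A ↣ ℕ
List↣ℕ i = mk↣ {to = code ∘ List.map (Injection.to i)}
  (List.map-injective (Injection.injective i) ∘ code-injective)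

×↣ℕ : {A B : Set} → A ↣ ℕ → B ↣ ℕ → (A × B) ↣ ℕ
×↣ℕ i j = mk↣ {to = λ (a , b) → code (Injection.to i a ∷ Injection.to j b ∷ [])} λ eq →
  let eq′ = code-injective eq
  in cong₂ _,_ (Injection.injective i (List.∷-injectiveˡ eq′))
               (Injection.injective j (List.∷-injectiveˡ (List.∷-injectiveʳ eq′)))

-- Countable sets and Souslin sets.

module _ {A : Set} where

  Countable-⊆ : {P Q : Pred A 0ℓ} → P ⊆ Q → Countable Q → Countable P
  Countable-⊆ P⊆Q (f , inj) = f , λ x∈P y∈P → inj (P⊆Q x∈P) (P⊆Q y∈P)

  Countable-subsingleton : {P : Pred A 0ℓ} → (∀ {x y} → x ∈ P → y ∈ P → x ≡ y) → Countable P
  Countable-subsingleton sub = (λ _ → 0) , λ x∈P y∈P _ → sub x∈P y∈P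

Countable-⊢ : {A A′ : Set} {f : A′ → A} → (∀ {x y} → f x ≡ f y → x ≡ y) →
  {P : Pred A 0ℓ} → Countable P → Countable (f ⊢ P)
Countable-⊢ {f = f} f-injective (g , inj) = g ∘ f , λ p q eq → f-injective (inj p q eq)

-- `π` acts letter by letter, so the first `n` letters of a code determine the first `n` bits of the
-- point. `closed` is topological closedness in terms of initial segments.
record Souslin (B : Pred (ℕ → Bool) 0ℓ) : Set₁ where
  field
    G      : Set
    encode : G ↣ ℕ
    π      : G → Bool
    F      : Pred (ℕ → G) 0ℓ
    closed : ∀ γ → (∀ n → ∃[ δ ] δ ∈ F × Agree n γ δ) → γ ∈ F
    image  : B ≐ λ t → ∃[ γ ] γ ∈ F × π ∘ γ ≡ t

-- Countable ordinals and their trees.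

-- Brouwer trees, which code the countable ordinals.
data Ord : Set where
  zero : Ord
  sup  : (ℕ → Ord) → Ord

infix 4 _≼_ _≺_ _≃_

-- `sup f` stands for the least ordinal strictly above every `f n`, which dictates the clauses of
-- both orders.
_≼_ : Ord → Ord → Set
zero  ≼ _     = ⊤
sup f ≼ zero  = ⊥
sup f ≼ sup g = ∀ m → ∃[ n ] f m ≼ g n

_≺_ : Ord → Ord → Set
a ≺ zero  = ⊥
a ≺ sup f = ∃[ n ] a ≼ f n

_≃_ : Ord → Ord → Set
a ≃ b = a ≼ b × b ≼ a

≼-refl : ∀ a → a ≼ a
≼-refl zero    = tt
≼-refl (sup f) = λ m → m , ≼-refl (f m)

≼-trans : ∀ a b c → a ≼ b → b ≼ c → a ≼ c
≼-trans zero    _       _       _ _ = tt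
≼-trans (sup f) (sup g) (sup h) p q m =
  let n , fm≼gn = p m
      k , gn≼hk = q n
  in k , ≼-trans (f m) (g n) (h k) fm≼gn gn≼hk

sup-least : ∀ f a → (∀ m → f m ≺ a) → sup f ≼ a
sup-least f zero    p = p 0
sup-least f (sup g) p = p

sup-upper : ∀ f a → sup f ≼ a → ∀ m → f m ≺ a
sup-upper f (sup g) p = p

≺-irrefl : ∀ a → ¬ a ≺ a
≺-irrefl (sup f) (n , p) = ≺-irrefl (f n) (sup-upper f (f n) p n)

≃-refl : ∀ a → a ≃ a
≃-refl a = ≼-refl a , ≼-refl a

≃-sym : ∀ {a b} → a ≃ b → b ≃ a
≃-sym (p , q) = q , p

≃-trans : ∀ {a b c} → a ≃ b → b ≃ c → a ≃ c
≃-trans {a} {b} {c} (p , q) (r , s) = ≼-trans a b c p r , ≼-trans c b a s q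

child : Ord → ℕ → Maybe Ord
child zero    n = nothing
child (sup f) n = just (f n)

-- Finite sequences are listed with the last term first.
subtree : Ord → List ℕ → Maybe Ord
subtree a []      = just a
subtree a (n ∷ σ) = subtree a σ Maybe.>>= λ b → child b n

tree : Ord → ℕ → Bool
tree a m = is-just (subtree a (decode m))

tree-code : ∀ a σ → tree a (code σ) ≡ is-just (subtree a σ)
tree-code a σ = cong (is-just ∘ subtree a) (decode-code σ)

subtree-tail : ∀ a n σ → is-just (subtree a (n ∷ σ)) ≡ true → is-just (subtree a σ) ≡ true
subtree-tail a n σ p with subtree a σ
... | just _ = refl

subtree-drop : ∀ a i σ → is-just (subtree a σ) ≡ true → is-just (subtree a (drop i σ)) ≡ true
subtree-drop a zero    σ       p = p
subtree-drop a (suc i) []      p = p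
subtree-drop a (suc i) (n ∷ σ) p = subtree-drop a i σ (subtree-tail a n σ p)

subtree-child : ∀ a σ {b} n → subtree a σ ≡ just b → subtree a (n ∷ σ) ≡ child b n
subtree-child a σ n eq = cong (Maybe._>>= λ b → child b n) eq

-- Both trees have the same nodes, so they can be descended in parallel: a child on the left is a
-- node, hence also a child on the right.
tree-reflects-≼ : ∀ a b → tree a ≡ tree b → a ≼ b
tree-reflects-≼ a b eq = go a b [] refl refl
  where
  same : ∀ σ → is-just (subtree a σ) ≡ is-just (subtree b σ)
  same σ = trans (sym (tree-code a σ)) (trans (cong-app eq (code σ)) (tree-code b σ))

  go : ∀ a′ b′ σ → subtree a σ ≡ just a′ → subtree b σ ≡ just b′ → a′ ≼ b′
  go zero    _ _ _ _ = tt
  go (sup f) b′ σ p q = sup-least f b′ λ m → step b′ q m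
    where
    step : ∀ b′ → subtree b σ ≡ just b′ → ∀ m → f m ≺ b′
    step zero q m
      with () ← trans (cong is-just (sym (subtree-child a σ m p)))
                      (trans (same (m ∷ σ)) (cong is-just (subtree-child b σ m q)))
    step (sup g) q m =
      m , go (f m) (g m) (m ∷ σ) (subtree-child a σ m p) (subtree-child b σ m q)

-- `t` need not be closed under initial segments; only the codes along `β` are tested.
IllFounded : Pred (ℕ → Bool) 0ℓ
IllFounded t = ∃[ β ] ∀ n → t (code (applyDownFrom β n)) ≡ true

-- The subtrees along a branch are successive children of one another, and structural recursion ends
-- at `zero`, which has none.
tree-wellFounded : ∀ a → tree a ∉ IllFounded
tree-wellFounded a (β , branch) = go a 0 refl
  where
  go : ∀ b n → subtree a (applyDownFrom β n) ≡ just b → ⊥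
  go zero    n eq
    with () ← trans (sym (branch (suc n)))
                (trans (tree-code a (applyDownFrom β (suc n)))
                       (cong is-just (subtree-child a (applyDownFrom β n) (β n) eq)))
  go (sup f) n eq = go (f (β n)) (suc n) (subtree-child a (applyDownFrom β n) (β n) eq)

module Classical
  (em  : ∀ {ℓ} → ExcludedMiddle ℓ)
  (ext : ∀ {a b} → Extensionality a b)
  where

  dne : ∀ {ℓ} {P : Set ℓ} → ¬ ¬ P → P
  dne = decidable-stable em

  ¬∀⇒∃¬ : {A : Set} {P : A → Set} → ¬ (∀ x → P x) → ∃[ x ] ¬ P x
  ¬∀⇒∃¬ ¬∀ = dne λ ¬∃ → ¬∀ λ x → dne λ ¬Px → ¬∃ (x , ¬Px)

  module _ {A : Set} where

    Countable-⋃ : {I : Set} → I ↣ ℕ → {Q : I → Pred A 0ℓ} →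
      (∀ i → Countable (Q i)) → Countable (⋃ I Q)
    Countable-⋃ {I} enc {Q} cQ = (λ x → f x em) , λ {x} {y} p q → inj x y em em p q
      where
      f : ∀ x → Dec (⋃ I Q x) → ℕ
      f x (yes (i , _)) = code (Injection.to enc i ∷ proj₁ (cQ i) x ∷ [])
      f x (no _)        = 0

      inj : ∀ x y (d : Dec (⋃ I Q x)) (e : Dec (⋃ I Q y)) →
        x ∈ ⋃ I Q → y ∈ ⋃ I Q → f x d ≡ f y e → x ≡ y
      inj x y (no ¬p) _ p _ _ = contradiction p ¬p
      inj x y _ (no ¬q) _ q _ = contradiction q ¬q
      inj x y (yes (i , x∈Qi)) (yes (j , y∈Qj)) _ _ eq
        with eq′ ← code-injective eq
        with refl ← Injection.injective enc (List.∷-injectiveˡ eq′) =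
        proj₂ (cQ i) x∈Qi y∈Qj (List.∷-injectiveˡ (List.∷-injectiveʳ eq′))

    Countable-∪ : {P Q : Pred A 0ℓ} → Countable P → Countable Q → Countable (P ∪ Q)
    Countable-∪ {P} {Q} cP cQ =
      Countable-⊆ (λ { (inj₁ p) → true , p ; (inj₂ q) → false , q })
        (Countable-⋃ Bool↣ℕ {λ b → if b then P else Q} λ { true → cP ; false → cQ })

  -- The perfect set theorem.

  module PerfectSet {B : Pred (ℕ → Bool) 0ℓ} (souslin : Souslin B)
                    (uncountable : ¬ Countable B) where
    open Souslin souslin

    Part : (ℕ → G) → ℕ → Pred (ℕ → Bool) 0ℓ
    Part γ n t = ∃[ δ ] δ ∈ F × Agree n γ δ × π ∘ δ ≡ t

    Big : (ℕ → G) → ℕ → Set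
    Big γ n = ¬ Countable (Part γ n)

    record Splitting (γ : ℕ → G) (n : ℕ) : Set where
      field
        m        : ℕ
        left     : ℕ → G
        right    : ℕ → G
        extendsˡ : Agree n γ left
        extendsʳ : Agree n γ right
        bigˡ     : Big left m
        bigʳ     : Big right m
        k        : ℕ
        n≤k      : n ≤ k
        k<m      : k < m
        diverge  : π (left k) ≢ π (right k)

    -- Without a splitting, the codes extending the given segment that stay big at all greater
    -- lengths yield a single point. Every other point lies in one of countably many countable
    -- parts, indexed by finite words, so the whole part would be countable.
    splitting : ∀ γ n → Big γ n → Splitting γ n
    splitting γ n big = dne λ ¬split →
      big (Countable-⊆ cover (Countable-∪ (Countable-subsingleton (thick-unique ¬split))
                                          (Countable-⋃ (List↣ℕ encode) Small-countable)))
      where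
      Thick : Pred (ℕ → Bool) 0ℓ
      Thick t = ∃[ δ ] Agree n γ δ × (∀ m → n ≤ m → Big δ m) × π ∘ δ ≡ t

      Small : List G → Pred (ℕ → Bool) 0ℓ
      Small ℓ t = ∃[ δ ] ∃[ m ] applyDownFrom δ m ≡ ℓ × Countable (Part δ m) × t ∈ Part δ m

      cover : Part γ n ⊆ Thick ∪ ⋃ (List G) Small
      cover (δ , δ∈F , γ≈δ , eq) with em {P = ∀ m → n ≤ m → Big δ m}
      ... | yes thick = inj₁ (δ , γ≈δ , thick , eq)
      ... | no ¬thick =
        let m , ¬m = ¬∀⇒∃¬ ¬thick
        in inj₂ (applyDownFrom δ m , δ , m , refl
                , dne (λ ¬c → ¬m λ _ → ¬c) , δ , δ∈F , (λ _ _ → refl) , eq)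

      thick-unique : ¬ Splitting γ n → ∀ {t u} → t ∈ Thick → u ∈ Thick → t ≡ u
      thick-unique ¬split (δ , γ≈δ , thickδ , refl) (ε , γ≈ε , thickε , refl) =
        ext λ k → dne λ δk≢εk → ¬split record
          { m        = n ⊔ suc k
          ; extendsˡ = γ≈δ
          ; extendsʳ = γ≈ε
          ; bigˡ     = thickδ _ (ℕ.m≤m⊔n n (suc k))
          ; bigʳ     = thickε _ (ℕ.m≤m⊔n n (suc k))
          ; n≤k      = ℕ.≮⇒≥ λ k<n → δk≢εk (cong π (trans (sym (γ≈δ k k<n)) (γ≈ε k k<n)))
          ; k<m      = ℕ.m≤n⊔m n (suc k)
          ; diverge  = δk≢εk
          }

      Small-countable : ∀ ℓ → Countable (Small ℓ)
      Small-countable ℓ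
        with em {P = ∃[ δ ] ∃[ m ] applyDownFrom δ m ≡ ℓ × Countable (Part δ m)}
      ... | no none = Countable-subsingleton λ (δ , m , eq , c , _) _ →
              contradiction (δ , m , eq , c) none
      ... | yes (δ , m , refl , c) = Countable-⊆
              (λ (δ′ , m′ , eq , _ , ε , ε∈F , δ′≈ε , eq′) →
                let m′≡m , δ′≈δ = prefix-injective m′ m eq
                in ε , ε∈F
                 , subst (λ l → Agree l δ ε) m′≡m (Agree-trans (Agree-sym δ′≈δ) δ′≈ε) , eq′)
              c

    State : Set
    State = ∃[ γ ] ∃[ n ] Big γ n

    step : State → Bool → State
    step (γ , n , big) b = (if b then left else right) , m , bigs b
      where
      open Splitting (splitting γ n big)
      bigs : ∀ b → Big (if b then left else right) m
      bigs true  = bigˡ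
      bigs false = bigʳ

    root : State
    root = γ , 0 , λ c → uncountable (Countable-⊆ (λ t∈B →
        let δ , δ∈F , eq = proj₁ image t∈B in δ , δ∈F , (λ _ ()) , eq) c)
      where
      nonempty : ∃ F
      nonempty = dne λ empty → uncountable (Countable-subsingleton λ t∈B _ →
        let δ , δ∈F , _ = proj₁ image t∈B in contradiction (δ , δ∈F) empty)
      γ = proj₁ nonempty

    node : (ℕ → Bool) → ℕ → State
    node x zero    = root
    node x (suc j) = step (node x j) (x j)

    point : State → ℕ → G
    point = proj₁

    height : State → ℕ
    height = proj₁ ∘ proj₂

    step-extends : ∀ s b → Agree (height s) (point s) (point (step s b))
    step-extends (γ , n , big) true  = Splitting.extendsˡ (splitting γ n big)
    step-extends (γ , n , big) false = Splitting.extendsʳ (splitting γ n big)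

    step-height : ∀ s b → height s < height (step s b)
    step-height (γ , n , big) b = ℕ.≤-<-trans n≤k k<m
      where open Splitting (splitting γ n big)

    step-diverge : ∀ s b c → b ≢ c →
      ∃[ k ] k < height (step s b) × π (point (step s b) k) ≢ π (point (step s c) k)
    step-diverge (γ , n , big) true  true  b≢c = contradiction refl b≢c
    step-diverge (γ , n , big) false false b≢c = contradiction refl b≢c
    step-diverge (γ , n , big) true  false _   = k , k<m , diverge
      where open Splitting (splitting γ n big)
    step-diverge (γ , n , big) false true  _   = k , k<m , diverge ∘ sym
      where open Splitting (splitting γ n big)

    node-cong : ∀ {x y} j → Agree j x y → node x j ≡ node y j
    node-cong zero    p = refl
    node-cong (suc j) p =
      cong₂ step (node-cong j (Agree-≤ (ℕ.n≤1+n j) p)) (p j ℕ.≤-refl)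

    height-≥ : ∀ x j → j ≤ height (node x j)
    height-≥ x zero    = z≤n
    height-≥ x (suc j) = ℕ.≤-<-trans (height-≥ x j) (step-height (node x j) (x j))

    node-extends : ∀ x j d → Agree (height (node x j)) (point (node x j)) (point (node x (d + j)))
    height-mono  : ∀ x j d → height (node x j) ≤ height (node x (d + j))

    height-mono x j zero    = ℕ.≤-refl
    height-mono x j (suc d) =
      ℕ.≤-trans (height-mono x j d) (ℕ.<⇒≤ (step-height (node x (d + j)) (x (d + j))))

    node-extends x j zero    = λ _ _ → refl
    node-extends x j (suc d) = Agree-trans (node-extends x j d)
      (Agree-≤ (height-mono x j d) (step-extends (node x (d + j)) (x (d + j))))

    node-extends-≤ : ∀ x {j k} → j ≤ k → Agree (height (node x j)) (point (node x j)) (point (node x k))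
    node-extends-≤ x {j} {k} j≤k =
      subst (λ l → Agree _ (point (node x j)) (point (node x l))) (ℕ.m∸n+n≡m j≤k)
        (node-extends x j (k ℕ.∸ j))

    limit : (ℕ → Bool) → ℕ → G
    -- At level `suc i` the height already exceeds `i`, so letter `i` no longer changes.
    limit x i = point (node x (suc i)) i

    limit-agree : ∀ x j → Agree (height (node x j)) (point (node x j)) (limit x)
    limit-agree x j i i<h with ℕ.≤-total j (suc i)
    ... | inj₁ j≤1+i = node-extends-≤ x j≤1+i i i<h
    ... | inj₂ 1+i≤j = sym (node-extends-≤ x 1+i≤j i (height-≥ x (suc i)))

    limit∈F : ∀ x → limit x ∈ F
    limit∈F x = closed (limit x) λ n →
      let γ , h , big = node x n
          δ , δ∈F , γ≈δ , _ = proj₂ (nonempty γ h big)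
      in δ , δ∈F , Agree-≤ (height-≥ x n) (Agree-trans (Agree-sym (limit-agree x n)) γ≈δ)
      where
      nonempty : ∀ γ n → Big γ n → ∃ (Part γ n)
      nonempty γ n big = dne λ empty →
        big (Countable-subsingleton λ p _ → contradiction (_ , p) empty)

    φ : (ℕ → Bool) → (ℕ → Bool)
    φ x = π ∘ limit x

    φ∈B : ∀ x → φ x ∈ B
    φ∈B x = proj₂ image (limit x , limit∈F x , refl)

    φ-continuous : ∀ {x y} n → Agree n x y → Agree n (φ x) (φ y)
    φ-continuous {x} {y} n p = Agree-cong π (Agree-trans
      (Agree-sym (Agree-≤ (height-≥ x n) (limit-agree x n)))
      (subst (λ s → Agree n (point s) (limit y)) (sym (node-cong n p))
        (Agree-≤ (height-≥ y n) (limit-agree y n))))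

    -- By induction `x` and `y` share the node at level `n`. Leaving it on different sides would
    -- make the images differ at the diverging coordinate, which lies below the height.
    φ-open : ∀ {x y} n → Agree (height (node x n)) (φ x) (φ y) → Agree n x y
    φ-open zero    p = λ _ ()
    φ-open {x} {y} (suc n) p = Agree-suc x≈y (dne λ xn≢yn →
      let k , k<h , ≢ = step-diverge (node x n) (x n) (y n) xn≢yn
      in ≢ (trans (cong π (limit-agree x (suc n) k k<h))
           (trans (p k k<h) (sym (trans
             (cong (λ s → π (point (step s (y n)) k)) (node-cong n x≈y))
             (cong π (limit-agree y (suc n) k (subst (k <_)
               (cong (λ s → height (step s (y n))) (node-cong n x≈y))
               k<h))))))))
      where
      x≈y : Agree n x y
      x≈y = φ-open n (Agree-≤ (ℕ.<⇒≤ (step-height (node x n) (x n))) p)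

  -- Ranks and the choice of one tree for each rank.

  module Rank {H : Set} (enc : H ↣ ℕ) (W : Pred (List H) 0ℓ) where

    _⊏_ : List H → List H → Set
    ℓ′ ⊏ ℓ = ∃[ h ] ℓ′ ≡ h ∷ ℓ × W ℓ′

    acc-or-branch : ¬ Acc _⊏_ [] → ∃[ η ] ∀ n → W (applyDownFrom η (suc n))
    acc-or-branch ¬acc = η , λ n → subst W (stage≡ (suc n)) (stage∈W n)
      where
      next : ((ℓ , _) : Σ (List H) λ ℓ → ¬ Acc _⊏_ ℓ) → ∃[ h ] W (h ∷ ℓ) × ¬ Acc _⊏_ (h ∷ ℓ)
      next (ℓ , ¬acc) = dne λ none → ¬acc (acc λ { (h , refl , w) →
        dne λ ¬acc′ → none (h , w , ¬acc′) })

      stage : ℕ → Σ (List H) λ ℓ → ¬ Acc _⊏_ ℓ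
      stage zero    = [] , ¬acc
      stage (suc n) = let h , _ , ¬acc′ = next (stage n) in h ∷ proj₁ (stage n) , ¬acc′

      η : ℕ → H
      η n = proj₁ (next (stage n))

      stage∈W : ∀ n → W (proj₁ (stage (suc n)))
      stage∈W n = proj₁ (proj₂ (next (stage n)))

      stage≡ : ∀ n → proj₁ (stage n) ≡ applyDownFrom η n
      stage≡ zero    = refl
      stage≡ (suc n) = cong (η n ∷_) (stage≡ n)

    Child : List H → ℕ → Set
    Child ℓ k = ∃[ h ] Injection.to enc h ≡ k × W (h ∷ ℓ)

    rank : ∀ {ℓ} → Acc _⊏_ ℓ → Ord
    rank-child : ∀ {ℓ k} → (∀ {ℓ′} → ℓ′ ⊏ ℓ → Acc _⊏_ ℓ′) → Dec (Child ℓ k) → Ord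

    rank {ℓ} (acc rs) = sup λ k → rank-child {ℓ} {k} rs em

    rank-child rs (yes (h , _ , w)) = rank (rs (h , refl , w))
    -- `zero` fills the indices that code no child. It can raise the rank of a leaf, which does no
    -- harm to an upper bound.
    rank-child rs (no _)            = zero

    -- The bound is assumed for every accessibility proof because `rank` supplies its own. It also
    -- selects its own child of the given index, which injectivity of `enc` identifies with `h`.
    ≺-rank : ∀ {a ℓ} h → W (h ∷ ℓ) → (ac : Acc _⊏_ ℓ) →
      (∀ ac′ → a ≼ rank {h ∷ ℓ} ac′) → a ≺ rank ac
    ≺-rank {a} {ℓ} h w (acc rs) p = Injection.to enc h , go em
      where
      go : (d : Dec (Child ℓ (Injection.to enc h))) → a ≼ rank-child rs d
      go (no ¬c) = contradiction (h , refl , w) ¬c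
      go (yes (h′ , eq , w′)) with refl ← Injection.injective enc eq = p (rs (h′ , refl , w′))

  -- If some `f m` lies below no `g n`, then by induction every `g n` is `≺ f m`, so that
  -- `sup g ≼ f m`.
  ≼-or-≺ : ∀ a b → a ≼ b ⊎ b ≺ a
  ≼-or-≺ zero    b       = inj₁ tt
  ≼-or-≺ (sup f) zero    = inj₂ (0 , tt)
  ≼-or-≺ (sup f) (sup g) with em {P = ∃[ m ] ∀ n → ¬ f m ≼ g n}
  ... | yes (m , f⋠g) = inj₂ (m , sup-least g (f m) λ n →
    [ (λ p → contradiction p (f⋠g n)) , id ]′ (≼-or-≺ (f m) (g n)))
  ... | no ¬f⋠g = inj₁ λ m → dne λ none → ¬f⋠g (m , λ n p → none (n , p))

  -- The characteristic function of a ≃-class depends on the class only, hence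
  -- so does the element of it that excluded middle selects.
  representative : (Ord → Bool) → Ord
  representative χ with em {P = ∃[ a ] χ a ≡ true}
  ... | yes (a , _) = a
  ... | no _        = zero

  class : Ord → Ord → Bool
  class a b = isYes (em {P = a ≃ b})

  class-sound : ∀ {a b} → class a b ≡ true → a ≃ b
  class-sound {a} {b} eq with em {P = a ≃ b}
  ... | yes p = p

  class-complete : ∀ {a b} → a ≃ b → class a b ≡ true
  class-complete {a} {b} p with em {P = a ≃ b}
  ... | yes _ = refl
  ... | no ¬p = contradiction p ¬p

  class-cong : ∀ {a b} → a ≃ b → class a ≡ class b
  class-cong {a} {b} p = ext λ c → iff (class a c) (class b c)
    (λ eq → class-complete (≃-trans (≃-sym p) (class-sound eq)))
    (λ eq → class-complete (≃-trans p (class-sound eq)))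
    where
    iff : ∀ x y → (x ≡ true → y ≡ true) → (y ≡ true → x ≡ true) → x ≡ y
    iff true  y     x⇒y y⇒x = sym (x⇒y refl)
    iff false true  x⇒y y⇒x = y⇒x refl
    iff false false x⇒y y⇒x = refl

  canonical : Ord → Ord
  canonical a = representative (class a)

  canonical-≃ : ∀ a → a ≃ canonical a
  canonical-≃ a with em {P = ∃[ b ] class a b ≡ true}
  ... | yes (b , eq) = class-sound eq
  ... | no none      = contradiction (a , class-complete (≃-refl a)) none

  canonical-cong : ∀ {a b} → a ≃ b → canonical a ≡ canonical b
  canonical-cong p = cong representative (class-cong p)

  Selector : Pred (ℕ → Bool) 0ℓ
  Selector t = ∃[ a ] tree (canonical a) ≡ t

  tree-canonical-reflects-≃ : ∀ {a b} → tree (canonical a) ≡ tree (canonical b) → a ≃ b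
  tree-canonical-reflects-≃ {a} {b} eq = ≃-trans (canonical-≃ a) (≃-trans
    (tree-reflects-≼ _ _ eq , tree-reflects-≼ _ _ (sym eq)) (≃-sym (canonical-≃ b)))

  -- `g` picks an ordinal for each value of `f`, so `sup g` lies strictly above an ordinal with the
  -- same value as itself, that is, one equivalent to it.
  Ord-uncountable : (f : Ord → ℕ) → (∀ {a b} → f a ≡ f b → a ≃ b) → ⊥
  Ord-uncountable f inj = ≺-irrefl a (f a , proj₁ (inj (sym (f∘g (f a) (a , refl)))))
    where
    g : ℕ → Ord
    g n with em {P = ∃[ b ] f b ≡ n}
    ... | yes (b , _) = b
    ... | no _        = zero

    f∘g : ∀ n → (∃[ b ] f b ≡ n) → f (g n) ≡ n
    f∘g n p with em {P = ∃[ b ] f b ≡ n}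
    ... | yes (_ , eq) = eq
    ... | no none      = contradiction p none

    a = sup g

  Below : Ord → Pred (ℕ → Bool) 0ℓ
  Below b t = ∃[ a ] a ≼ b × tree (canonical a) ≡ t

  -- A rank up to `sup f` either is equivalent to it, which yields one tree thanks to `canonical`,
  -- or lies below some `f n`.
  Below-countable : ∀ b → Countable (Below b)
  Below-countable zero = Countable-subsingleton λ
    { (a , a≼ , refl) (a′ , a′≼ , refl) →
      cong tree (canonical-cong (≃-trans (a≼ , tt) (≃-sym (a′≼ , tt)))) }
  Below-countable (sup f) = Countable-⊆ cover
    (Countable-∪ (Countable-subsingleton unique) (Countable-⋃ ℕ↣ℕ λ n → Below-countable (f n)))
    where
    Equal : Pred (ℕ → Bool) 0ℓ
    Equal t = ∃[ a ] a ≃ sup f × tree (canonical a) ≡ t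

    unique : ∀ {t u} → t ∈ Equal → u ∈ Equal → t ≡ u
    unique (a , p , refl) (b , q , refl) = cong tree (canonical-cong (≃-trans p (≃-sym q)))

    cover : Below (sup f) ⊆ Equal ∪ ⋃ ℕ (Below ∘ f)
    cover (a , a≼ , eq) with ≼-or-≺ (sup f) a
    ... | inj₁ ≼a        = inj₁ (a , (a≼ , ≼a) , eq)
    ... | inj₂ (n , a≼fn) = inj₂ (n , a , a≼fn , eq)

  -- Boundedness: the attempts to build both a point of B and a branch through
  -- the tree that it codes form a well-founded tree, whose rank dominates the
  -- rank of every tree coded in B.
  module Boundedness {B : Pred (ℕ → Bool) 0ℓ} (souslin : Souslin B)
                     (disjoint : ∀ {t} → t ∈ B → t ∉ IllFounded) where
    open Souslin souslin

    -- `drop i` runs through the initial segments of the finite sequence of second components. Their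
    -- codes may lie beyond the prefix fixed by `ℓ`, so they are tested on an extension `δ` in `F`,
    -- which may change from one attempt to the next.
    W : Pred (List (G × ℕ)) 0ℓ
    W ℓ = ∃[ δ ] δ ∈ F × List.map proj₁ ℓ ≡ applyDownFrom δ (length ℓ) ×
      (∀ i → π (δ (code (drop i (List.map proj₂ ℓ)))) ≡ true)

    open Rank (×↣ℕ encode ℕ↣ℕ) W

    no-branch : ∀ η → ¬ (∀ n → W (applyDownFrom η (suc n)))
    no-branch η branch = disjoint (proj₂ image (γ , γ∈F , refl)) (β , γ-branch)
      where
      γ = proj₁ ∘ η
      β = proj₂ ∘ η

      approximates : ∀ n → Agree n γ (proj₁ (branch n))
      approximates n =
        let δ , _ , eq , _ = branch n
        in Agree-≤ (ℕ.n≤1+n n) (proj₂ (prefix-injective (suc n) _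
             (trans (sym (List.map-applyDownFrom η proj₁ (suc n))) eq)))

      γ∈F : γ ∈ F
      γ∈F = closed γ λ n → let δ , δ∈F , _ = branch n in δ , δ∈F , approximates n

      γ-branch : ∀ n → π (γ (code (applyDownFrom β n))) ≡ true
      γ-branch n =
        let c = code (applyDownFrom β n)
            -- This attempt is long enough for `δ` to agree with `γ` at `c`, and dropping
            -- `suc (suc c)` of its terms leaves the first `n`.
            δ , _ , _ , p = branch (suc c + n)
        in trans (cong π (approximates (suc c + n) c (s≤s (ℕ.m≤m+n c n))))
             (subst (λ σ → π (δ (code σ)) ≡ true)
               (trans (cong (drop (suc (suc c)))
                        (List.map-applyDownFrom η proj₂ (suc (suc c) + n)))
                      (drop-prefix β (suc (suc c)) n))
               (p (suc (suc c))))

    root-acc : Acc _⊏_ []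
    root-acc = dne λ ¬acc → let η , branch = acc-or-branch ¬acc in no-branch η branch

    -- Attaching to the nodes of `tree a` the letters of a fixed code `γ` of that tree embeds it
    -- among the attempts, and an embedding cannot lower ranks.
    bounded : ∀ a → tree a ∈ B → a ≼ rank root-acc
    bounded a a∈B = embed a [] refl root-acc
      where
      γ     = proj₁ (proj₁ image a∈B)
      γ∈F   = proj₁ (proj₂ (proj₁ image a∈B))
      πγ≡a  = proj₂ (proj₂ (proj₁ image a∈B))

      at : List ℕ → List (G × ℕ)
      at []      = []
      at (n ∷ σ) = (γ (length σ) , n) ∷ at σ

      length-at : ∀ σ → length (at σ) ≡ length σ
      length-at []      = refl
      length-at (n ∷ σ) = cong suc (length-at σ)

      proj₁-at : ∀ σ → List.map proj₁ (at σ) ≡ applyDownFrom γ (length (at σ))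
      proj₁-at []      = refl
      proj₁-at (n ∷ σ) = cong₂ _∷_ (cong γ (sym (length-at σ))) (proj₁-at σ)

      proj₂-at : ∀ σ → List.map proj₂ (at σ) ≡ σ
      proj₂-at []      = refl
      proj₂-at (n ∷ σ) = cong (n ∷_) (proj₂-at σ)

      at∈W : ∀ σ {b} → subtree a σ ≡ just b → W (at σ)
      at∈W σ eq = γ , γ∈F , proj₁-at σ , λ i →
        subst (λ τ → π (γ (code (drop i τ))) ≡ true) (sym (proj₂-at σ))
          (trans (cong-app πγ≡a _) (trans (tree-code a (drop i σ))
            (subtree-drop a i σ (cong is-just eq))))

      embed : ∀ b σ → subtree a σ ≡ just b → (ac : Acc _⊏_ (at σ)) → b ≼ rank ac
      embed zero    σ eq ac = tt
      embed (sup f) σ eq ac = sup-least f (rank ac) λ n →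
        let eq′ = subtree-child a σ n eq
        in ≺-rank {f n} (γ (length σ) , n) (at∈W (n ∷ σ) eq′) ac
             (embed (f n) (n ∷ σ) eq′)

    selector-countable : Countable (Selector ∩ B)
    selector-countable = Countable-⊆ (λ { ((a , refl) , a∈B) →
        a , ≼-trans a _ _ (proj₁ (canonical-≃ a)) (bounded (canonical a) a∈B) , refl })
      (Below-countable (rank root-acc))

  -- Closure properties of Souslin sets.

  -- The letters of the witness `β` are paired with those of the code, so that the quantifier is
  -- absorbed into the projection.
  Souslin-∃ : {B : Pred (ℕ → Bool) 0ℓ} (H : (ℕ → Bool) → (ℕ → ℕ) → Set) →
    (∀ t β → (∀ n → ∃[ u ] ∃[ β′ ] H u β′ × Agree n t u × Agree n β β′) → H t β) →
    Souslin B → Souslin (λ t → t ∈ B × ∃ (H t))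
  Souslin-∃ H H-closed souslin = record
    { G      = G × ℕ
    ; encode = ×↣ℕ encode ℕ↣ℕ
    ; π      = π ∘ proj₁
    ; F      = λ γ → proj₁ ∘ γ ∈ F × H (π ∘ proj₁ ∘ γ) (proj₂ ∘ γ)
    ; closed = λ γ approx →
        closed (proj₁ ∘ γ) (λ n → let δ , (δ∈F , _) , γ≈δ = approx n
                                  in proj₁ ∘ δ , δ∈F , Agree-cong proj₁ γ≈δ)
      , H-closed _ _ (λ n → let δ , (_ , h) , γ≈δ = approx n
                            in π ∘ proj₁ ∘ δ , proj₂ ∘ δ , h
                             , Agree-cong (π ∘ proj₁) γ≈δ , Agree-cong proj₂ γ≈δ)
    ; image  = (λ (t∈B , β , h) → join (proj₁ image t∈B) h)
             , λ { (γ , (γ∈F , h) , refl) →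
                 proj₂ image (proj₁ ∘ γ , γ∈F , refl) , proj₂ ∘ γ , h }
    }
    where
    open Souslin souslin
    join : ∀ {t β} → (∃[ γ ] γ ∈ F × π ∘ γ ≡ t) → H t β →
      ∃[ γ ] (proj₁ ∘ γ ∈ F × H (π ∘ proj₁ ∘ γ) (proj₂ ∘ γ)) × π ∘ proj₁ ∘ γ ≡ t
    join {β = β} (γ , γ∈F , refl) h = (λ n → γ n , β n) , (γ∈F , h) , refl

  Souslin-∩-IllFounded : {B : Pred (ℕ → Bool) 0ℓ} → Souslin B → Souslin (B ∩ IllFounded)
  Souslin-∩-IllFounded = Souslin-∃ (λ t β → ∀ n → t (code (applyDownFrom β n)) ≡ true)
    λ t β approx n →
      let c = code (applyDownFrom β n)
          u , β′ , branch , t≈u , β≈β′ = approx (suc c + n)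
      in trans (t≈u c (s≤s (ℕ.m≤m+n c n)))
           (trans (cong (u ∘ code) (prefix-cong (Agree-≤ (ℕ.m≤n+m n (suc c)) β≈β′))) (branch n))

  -- The witness β turns t ∉ Q into a closed condition on (t , β).
  Avoids : {Q : Pred (ℕ → Bool) 0ℓ} → Countable Q → (ℕ → Bool) → (ℕ → ℕ) → Set
  Avoids {Q} (f , _) t β = ∀ i u → u ∈ Q → f u ≡ i → u (β i) ≢ t (β i)

  Souslin-avoiding : {B Q : Pred (ℕ → Bool) 0ℓ} (c : Countable Q) →
    Souslin B → Souslin (λ t → t ∈ B × ∃ (Avoids c t))
  Souslin-avoiding c = Souslin-∃ (Avoids c) λ t β approx i u u∈Q eq u≡t →
    let v , β′ , avoids , t≈v , β≈β′ = approx (suc (i + β i))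
        βi≡β′i = β≈β′ i (s≤s (ℕ.m≤m+n i (β i)))
    in avoids i u u∈Q eq
         (subst (λ k → u k ≡ v k) βi≡β′i (trans u≡t (t≈v (β i) (s≤s (ℕ.m≤n+m (β i) i)))))

  -- At most one point of `Q` has index `i`, so a single coordinate `β i` separates `t` from it; an
  -- index of no point gets the arbitrary value 0.
  avoid : {Q : Pred (ℕ → Bool) 0ℓ} (c : Countable Q) → ∀ t → t ∉ Q → ∃ (Avoids c t)
  avoid {Q} (f , inj) t t∉Q = (λ i → proj₁ (differ i)) , (λ i → proj₂ (differ i))
    where
    differ : ∀ i → ∃[ k ] ∀ u → u ∈ Q → f u ≡ i → u k ≢ t k
    differ i with em {P = ∃[ u ] u ∈ Q × f u ≡ i}
    ... | no none = 0 , λ u u∈Q eq _ → none (u , u∈Q , eq)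
    ... | yes (u , u∈Q , eq) =
      let k , u≢t = ¬∀⇒∃¬ λ u≗t → t∉Q (subst (_∈ Q) (ext u≗t) u∈Q)
      in k , λ v v∈Q eq′ v≡t → u≢t (trans (cong (λ w → w k) (inj u∈Q v∈Q (trans eq (sym eq′)))) v≡t)

  -- Topology in terms of initial segments.

  agree-by-coordinates : {A B : Set} (f : (ℕ → A) → (ℕ → B)) {x : ℕ → A} →
    (∀ i → ∃[ m ] ∀ y → Agree m x y → f x i ≡ f y i) →
    ∀ n → ∃[ m ] ∀ y → Agree m x y → Agree n (f x) (f y)
  agree-by-coordinates f p zero    = 0 , λ _ _ _ ()
  agree-by-coordinates f p (suc n) =
    let m , q = agree-by-coordinates f p n
        k , r = p n
    in m ⊔ k , λ y x≈y → Agree-suc (q y (Agree-≤ (ℕ.m≤m⊔n m k) x≈y))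
                                   (r y (Agree-≤ (ℕ.m≤n⊔m m k) x≈y))

  -- A space whose topology is that of its image under ι in A^ω.
  record SequenceSpace (X : Space) : Set₁ where
    field
      A           : Set
      encode      : A ↣ ℕ
      ι           : Carrier X → ℕ → A
      ι-injective : ∀ {x y} → ι x ≡ ι y → x ≡ y
      open⇒       : ∀ {V} → Open X V → ∀ x → x ∈ V → ∃[ n ] ∀ y → Agree n (ι x) (ι y) → y ∈ V
      open⇐       : ∀ {V} → (∀ x → x ∈ V → ∃[ n ] ∀ y → Agree n (ι x) (ι y) → y ∈ V) → Open X V

  A^ω : Set → Space
  A^ω A = Countable-product λ _ → Discrete A

  A^ω-sequence : {A : Set} → A ↣ ℕ → SequenceSpace (A^ω A)
  A^ω-sequence {A} enc = record
    { A           = A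
    ; encode      = enc
    ; ι           = id
    ; ι-injective = id
    ; open⇒       = λ oV x x∈V →
        let n , B , _ , x∈B , B⊆V = oV x x∈V
        in n , λ y x≈y → B⊆V y λ i i<n → subst (_∈ B i) (x≈y i i<n) (x∈B i)
    ; open⇐       = λ p x x∈V →
        let n , q = p x x∈V
        in n , (λ i a → x i ≡ a) , _ , (λ _ → refl) , q
    }

  Subspace-sequence : {X : Space} (Y : Subset X) → SequenceSpace X → SequenceSpace (Subspace X Y)
  Subspace-sequence {X} Y sequence = record
    { A           = A
    ; encode      = encode
    ; ι           = ι ∘ value
    ; ι-injective = value-injective ∘ ι-injective
    ; open⇒       = λ (W , oW , V⊆W , W⊆V) x x∈V →
        let n , p = open⇒ oW (value x) (V⊆W x∈V)
        in n , λ y x≈y → W⊆V (p (value y) x≈y)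
    ; open⇐       = λ {V} p →
        -- `W` is the union of the cylinders around points of the subspace whose traces lie in `V`.
        let W : Subset X
            W z = ∃[ x ] ∃[ n ] Agree n (ι (value x)) (ι z) ×
                    (∀ y → Agree n (ι (value x)) (ι (value y)) → y ∈ V)
        in W
         , open⇐ (λ z (x , n , x≈z , q) → n , λ y z≈y → x , n , Agree-trans x≈z z≈y , q)
         , (λ {x} x∈V → let n , q = p x x∈V in x , n , (λ _ _ → refl) , q)
         , (λ {y} (x , n , x≈y , q) → q y x≈y)
    }
    where open SequenceSpace sequence

  -- Rationals, cuts and metric balls.

  open ℝ

  -- `mkℚ` stores the denominator less one.
  1/1+ : ℕ → ℚ
  1/1+ n = mkℚ (ℤ.+ 1) n (1-coprimeTo (suc n))

  1/1+-positive : ∀ n → 0ℚ ℚ.< 1/1+ n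
  1/1+-positive n = ℚ.positive⁻¹ (1/1+ n)

  1/1+-antitone : ∀ {m n} → m ≤ n → 1/1+ n ℚ.≤ 1/1+ m
  1/1+-antitone m≤n = ℚ.*≤* (ℤ.*-monoˡ-≤-nonNeg (ℤ.+ 1) (ℤ.+≤+ (s≤s m≤n)))

  -- A positive fraction is at least the reciprocal of its denominator.
  archimedean : ∀ q → 0ℚ ℚ.< q → ∃[ n ] 1/1+ n ℚ.≤ q
  archimedean (mkℚ (ℤ.+ zero)  d _) (ℚ.*<* (ℤ.+<+ ()))
  archimedean (mkℚ ℤ.+[1+ k ] d _) _ =
    d , ℚ.*≤* (ℤ.*-monoʳ-≤-nonNeg (ℤ.+ suc d) (ℤ.+≤+ (s≤s (z≤n {k}))))
  archimedean (mkℚ ℤ.-[1+ k ] d _) (ℚ.*<* ())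

  halve : ∀ q → 0ℚ ℚ.< q → ∃[ r ] 0ℚ ℚ.< r × r ℚ.+ r ≡ q
  halve q 0<q = ℚ.½ ℚ.* q
    , subst (ℚ._< ℚ.½ ℚ.* q) (ℚ.*-zeroʳ ℚ.½) (ℚ.*-monoʳ-<-pos ℚ.½ 0<q)
    , trans (sym (ℚ.*-distribʳ-+ q ℚ.½ ℚ.½)) (ℚ.*-identityˡ q)

  +-difference : ∀ q r → r ℚ.+ (q ℚ.- r) ≡ q
  +-difference q r = trans (cong (r ℚ.+_) (ℚ.+-comm q (ℚ.- r)))
    (trans (sym (ℚ.+-assoc r (ℚ.- r) q))
      (trans (cong (ℚ._+ q) (ℚ.+-inverseʳ r)) (ℚ.+-identityˡ q)))

  split-below : ∀ {q b} → q ℚ.< b → ∃[ r ] ∃[ s ] r ℚ.< b × s ℚ.< 0ℚ × q ≡ r ℚ.+ s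
  split-below {q} q<b =
    let r , q<r , r<b = ℚ.<-dense q<b
    in r , q ℚ.- r , r<b
     , subst (q ℚ.- r ℚ.<_) (ℚ.+-inverseʳ r) (ℚ.+-monoˡ-< (ℚ.- r) q<r)
     , sym (+-difference q r)

  fromℚ : ℚ → ℝ
  fromℚ q = record
    { lower       = ℚ._< q
    ; inhabited   = q ℚ.- 1ℚ , subst (q ℚ.- 1ℚ ℚ.<_) (ℚ.+-identityʳ q)
                                 (ℚ.+-monoʳ-< q (ℚ.negative⁻¹ (ℚ.- 1ℚ)))
    ; bounded     = q , ℚ.<-irrefl refl
    ; down-closed = ℚ.<-trans
    ; no-maximum  = ℚ.<-dense
    }

  ≤-lower : ∀ z {p q} → p ℚ.≤ q → q ∈ lower z → p ∈ lower z
  ≤-lower z {p} {q} p≤q q∈z with ℚ.<-cmp p q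
  ... | tri< p<q _ _  = down-closed z p<q q∈z
  ... | tri≈ _ refl _ = q∈z
  ... | tri> _ _ q<p  = contradiction (ℚ.<-≤-trans q<p p≤q) (ℚ.<-irrefl refl)

  lower<upper : ∀ z {p q} → p ∈ lower z → q ∉ lower z → p ℚ.< q
  lower<upper z p∈z q∉z = ℚ.≰⇒> λ q≤p → q∉z (≤-lower z q≤p p∈z)

  upper-+ : ∀ x y {p q} → p ∉ lower x → q ∉ lower y → p ℚ.+ q ∉ lower (x +ℝ y)
  upper-+ x y p∉x q∉y (r , s , r∈x , s∈y , eq) =
    ℚ.<-irrefl (sym eq) (ℚ.+-mono-< (lower<upper x r∈x p∉x) (lower<upper y s∈y q∉y))

  positive-rational : ∀ ε → 0ℝ <ℝ ε → ∃[ q ] 0ℚ ℚ.< q × q ∈ lower ε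
  positive-rational ε (p , p≮0 , p∈ε) =
    let q , p<q , q∈ε = no-maximum ε p∈ε
    in q , ℚ.≤-<-trans (ℚ.≮⇒≥ p≮0) p<q , q∈ε

  0<fromℚ : ∀ {q} → 0ℚ ℚ.< q → 0ℝ <ℝ fromℚ q
  0<fromℚ 0<q = 0ℚ , ℚ.<-irrefl refl , 0<q

  ≤ℝ-isPartialOrder : IsPartialOrder _≈ℝ_ _≤ℝ_
  ≤ℝ-isPartialOrder = record
    { isPreorder = record
      { isEquivalence = record
        { refl  = id , id
        ; sym   = λ (p , q) → q , p
        ; trans = λ (p , q) (r , s) → r ∘ p , q ∘ s
        }
      ; reflexive = proj₁
      ; trans     = λ p q → q ∘ p
      }
    ; antisym = λ p q → p , q
    }

  module Metric {A : Set} {d : A → A → ℝ} (isMetric : IsMetric d) where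
    open IsGeneralMetric isMetric
      using (triangle; nonNegative; ≈⇒0; 0⇒≈) renaming (sym to d-sym)

    Ball-sym : ∀ {x y ε} → Ball d x ε y → Ball d y ε x
    Ball-sym {x} {y} (q , q∉ , q∈ε) = q , q∉ ∘ proj₂ (d-sym x y) , q∈ε

    Ball-refl : ∀ {x ε} → 0ℝ <ℝ ε → Ball d x ε x
    Ball-refl (q , q≮0 , q∈ε) = q , q≮0 ∘ proj₁ (≈⇒0 refl) , q∈ε

    Ball-trans : ∀ {x y z p q} → Ball d x (fromℚ p) y → Ball d y (fromℚ q) z →
      Ball d x (fromℚ (p ℚ.+ q)) z
    Ball-trans {x} {y} {z} (r , r∉ , r<p) (s , s∉ , s<q) =
      r ℚ.+ s , upper-+ (d x y) (d y z) r∉ s∉ ∘ triangle x y z , ℚ.+-mono-< r<p s<q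

    Ball-⊆ : ∀ {x y ε q} → q ∈ lower ε → Ball d x (fromℚ q) y → Ball d x ε y
    Ball-⊆ {ε = ε} q∈ε (r , r∉ , r<q) = r , r∉ , down-closed ε r<q q∈ε

    Ball-interior : ∀ {x y q} → Ball d x (fromℚ q) y →
      ∃[ ε ] 0ℝ <ℝ ε × Ball d y ε ⊆ Ball d x (fromℚ q)
    Ball-interior {x} {y} {q} (r , r∉ , r<q) = fromℚ (q ℚ.- r) , 0<fromℚ 0<q-r ,
      λ {z} (s , s∉ , s<q-r) → r ℚ.+ s , upper-+ (d x y) (d y z) r∉ s∉ ∘ triangle x y z ,
        subst (r ℚ.+ s ℚ.<_) (+-difference q r) (ℚ.+-monoʳ-< r s<q-r)
      where
      0<q-r : 0ℚ ℚ.< q ℚ.- r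
      0<q-r = subst (ℚ._< q ℚ.- r) (ℚ.+-inverseʳ r) (ℚ.+-monoˡ-< (ℚ.- r) r<q)

    -- If the balls met at every positive radius, the triangle inequality would leave no nonnegative
    -- rational in the cut of the distance, making it 0.
    Ball-disjoint : ∀ {x y} → x ≢ y → ∃[ q ] 0ℚ ℚ.< q ×
      (∀ z → Ball d x (fromℚ q) z → ¬ Ball d y (fromℚ q) z)
    Ball-disjoint {x} {y} x≢y = dne λ none → x≢y (0⇒≈
      ( (λ {q} q∈d → ℚ.≰⇒> λ 0≤q →
          let p , q<p , p∈d = no-maximum (d x y) q∈d
              r , 0<r , r+r≡p = halve p (ℚ.≤-<-trans 0≤q q<p)
          in none (r , 0<r , λ z xz yz →
            let s , s∉d , s<r+r = Ball-trans xz (Ball-sym {ε = fromℚ r} yz)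
            in s∉d (down-closed (d x y) (subst (s ℚ.<_) r+r≡p s<r+r) p∈d)))
      , nonNegative))

  module Induced {X : Space} {d : Carrier X → Carrier X → ℝ} (isMetric : IsMetric d)
                 (induces : Induces X d) where
    open Metric isMetric

    Ball-open : ∀ x q → Open X (Ball d x (fromℚ q))
    Ball-open x q = Equivalence.from (induces _) λ y → Ball-interior

  -- The metric of a sequence space.

  module SequenceMetric {X : Space} (sequence : SequenceSpace X) where
    open SequenceSpace sequence

    -- The cut of 1/(n+1) for the first `n` at which the sequences differ, and of 0 if there is
    -- none. A union over all differences has the same supremum and spares locating the first.
    Different : Carrier X → Carrier X → Pred ℚ 0ℓ
    Different x y q = q ℚ.< 0ℚ ⊎ ∃[ n ] ι x n ≢ ι y n × q ℚ.< 1/1+ n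

    d : Carrier X → Carrier X → ℝ
    d x y = record
      { lower       = Different x y
      ; inhabited   = ℚ.- 1ℚ , inj₁ (ℚ.negative⁻¹ (ℚ.- 1ℚ))
      ; bounded     = 1/1+ 0 , λ where
          (inj₁ p)           → ℚ.<-asym p (1/1+-positive 0)
          (inj₂ (n , _ , p)) → ℚ.<-irrefl refl (ℚ.<-≤-trans p (1/1+-antitone {0} {n} z≤n))
      ; down-closed = λ where
          p<q (inj₁ q<0)           → inj₁ (ℚ.<-trans p<q q<0)
          p<q (inj₂ (n , ≢ , q<n)) → inj₂ (n , ≢ , ℚ.<-trans p<q q<n)
      ; no-maximum  = λ where
          (inj₁ p<0) →
            let q , p<q , q<0 = ℚ.<-dense p<0 in q , p<q , inj₁ q<0
          (inj₂ (n , ≢ , p<n)) →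
            let q , p<q , q<n = ℚ.<-dense p<n in q , p<q , inj₂ (n , ≢ , q<n)
      }

    -- Where `x` and `z` differ, `y` differs from one of them, so one summand carries the bound and
    -- the other contributes a negative rational.
    d-triangle : ∀ x y z → d x z ≤ℝ (d x y +ℝ d y z)
    d-triangle x y z (inj₁ q<0) =
      let r , s , r<0 , s<0 , eq = split-below q<0
      in r , s , inj₁ r<0 , inj₁ s<0 , eq
    d-triangle x y z {q} (inj₂ (n , x≢z , q<n)) with em {P = ι x n ≡ ι y n} | split-below q<n
    ... | no x≢y  | r , s , r<n , s<0 , eq = r , s , inj₂ (n , x≢y , r<n) , inj₁ s<0 , eq
    ... | yes x≡y | r , s , r<n , s<0 , eq =
      s , r , inj₁ s<0 , inj₂ (n , (λ y≡z → x≢z (trans x≡y y≡z)) , r<n) , trans eq (ℚ.+-comm r s)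

    Ball⇒Agree : ∀ {x y} n → Ball d x (fromℚ (1/1+ n)) y → Agree (suc n) (ι x) (ι y)
    Ball⇒Agree n (r , r∉ , r<n) i i<1+n = dne λ x≢y →
      r∉ (inj₂ (i , x≢y , ℚ.<-≤-trans r<n (1/1+-antitone (ℕ.s≤s⁻¹ i<1+n))))

    Agree⇒upper : ∀ {x y} n → Agree n (ι x) (ι y) → 1/1+ n ∉ lower (d x y)
    Agree⇒upper n x≈y (inj₁ n<0) = ℚ.<-asym n<0 (1/1+-positive n)
    Agree⇒upper n x≈y (inj₂ (i , x≢y , n<i)) = x≢y (x≈y i (ℕ.≰⇒> λ n≤i →
      ℚ.<-irrefl refl (ℚ.<-≤-trans n<i (1/1+-antitone n≤i))))

    Agree⇒Ball : ∀ {x y ε} n → 1/1+ n ∈ lower ε → Agree n (ι x) (ι y) → Ball d x ε y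
    Agree⇒Ball n n∈ε x≈y = 1/1+ n , Agree⇒upper n x≈y , n∈ε

    small : ∀ ε → 0ℝ <ℝ ε → ∃[ n ] 1/1+ n ∈ lower ε
    small ε 0<ε =
      let q , 0<q , q∈ε = positive-rational ε 0<ε
          n , n≤q = archimedean q 0<q
      in n , ≤-lower ε n≤q q∈ε

    d-isMetric : IsMetric d
    d-isMetric = record
      { isSemiMetric = record
        { isQuasiSemiMetric = record
          { isPreMetric = record
            { isProtoMetric = record
              { isPartialOrder  = ≤ℝ-isPartialOrder
              ; ≈-isEquivalence = isEquivalence
              ; cong            = λ { refl refl → id , id }
              ; nonNegative     = inj₁
              }
            ; ≈⇒0 = λ { refl → (λ { (inj₁ q<0)           → q<0
                                  ; (inj₂ (_ , ≢ , _)) → contradiction refl ≢ }) , inj₁ }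
            }
          ; 0⇒≈ = λ {x} {y} (d≤0 , _) → ι-injective (ext λ n → dne λ x≢y →
              let q , 0<q , q<n = ℚ.<-dense (1/1+-positive n)
              in ℚ.<-asym 0<q (d≤0 (inj₂ (n , x≢y , q<n))))
          }
        ; sym = λ x y → swap , swap
        }
      ; triangle = d-triangle
      }
      where
      swap : ∀ {x y} → d x y ≤ℝ d y x
      swap (inj₁ q<0)           = inj₁ q<0
      swap (inj₂ (n , ≢ , q<n)) = inj₂ (n , ≢ ∘ sym , q<n)

    d-induces : Induces X d
    d-induces V = mk⇔
      (λ oV x x∈V →
        let n , p = open⇒ oV x x∈V
        in fromℚ (1/1+ n) , 0<fromℚ (1/1+-positive n)
         , λ {y} b → p y (Agree-≤ (ℕ.n≤1+n n) (Ball⇒Agree n b)))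
      (λ p → open⇐ λ x x∈V →
        let ε , 0<ε , ball⊆V = p x x∈V
            n , n∈ε = small ε 0<ε
        in n , λ y x≈y → ball⊆V (Agree⇒Ball {ε = ε} n n∈ε x≈y))

    metrizable : Metrizable X
    metrizable = d , d-isMetric , d-induces

    -- One point is chosen from each nonempty cylinder, and cylinders are indexed by finite words.
    separable : Separable X
    separable = ⋃ (List A) (λ ℓ → Chosen ℓ em)
      , Countable-⋃ (List↣ℕ encode) (λ ℓ → Countable-subsingleton (Chosen-unique ℓ em))
      , λ V oV (x , x∈V) →
          let n , p = open⇒ oV x x∈V
              y , y∈Chosen , eq = Chosen-nonempty _ em (x , prefix-length x n)
              _ , x≈y = prefix-injective {x = ι x} {ι y} n _ (sym eq)
          in y , (applyDownFrom (ι x) n , y∈Chosen) , p y x≈y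
      where
      Extension : List A → Carrier X → Set
      Extension ℓ x = applyDownFrom (ι x) (length ℓ) ≡ ℓ

      Chosen : ∀ ℓ → Dec (∃ (Extension ℓ)) → Pred (Carrier X) 0ℓ
      Chosen ℓ (yes (x , _)) y = x ≡ y
      Chosen ℓ (no _)        y = ⊥

      Chosen-unique : ∀ ℓ (c : Dec (∃ (Extension ℓ))) {x y} → x ∈ Chosen ℓ c → y ∈ Chosen ℓ c → x ≡ y
      Chosen-unique ℓ (yes _) refl refl = refl

      Chosen-nonempty : ∀ ℓ (c : Dec (∃ (Extension ℓ))) → ∃ (Extension ℓ) →
        ∃[ y ] y ∈ Chosen ℓ c × Extension ℓ y
      Chosen-nonempty ℓ (yes (x , p)) _ = x , refl , p
      Chosen-nonempty ℓ (no none)     p = contradiction p none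

      prefix-length : ∀ x n → Extension (applyDownFrom (ι x) n) x
      prefix-length x n = cong (applyDownFrom (ι x)) (List.length-applyDownFrom (ι x) n)

    complete : (∀ s → ∃[ x ] ι x ≡ s) → Complete d
    complete surjective s cauchy = x , converges
      where
      N : ℕ → ℕ
      N n = proj₁ (cauchy (fromℚ (1/1+ n)) (0<fromℚ (1/1+-positive n)))

      N-agree : ∀ n k l → N n ≤ k → N n ≤ l → Agree (suc n) (ι (s k)) (ι (s l))
      N-agree n k l N≤k N≤l =
        Ball⇒Agree n (proj₂ (cauchy (fromℚ (1/1+ n)) (0<fromℚ (1/1+-positive n))) k l N≤k N≤l)

      limit : ∃[ x ] ι x ≡ λ i → ι (s (N i)) i
      limit = surjective _

      x = proj₁ limit

      converges : Converges d s x
      converges ε 0<ε =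
        let n , n∈ε = small ε 0<ε
        in N n , λ k N≤k → Agree⇒Ball {ε = ε} n n∈ε λ i i<n →
          -- Stages `k` and `N i` are compared through `N n ⊔ N i`, which is late enough for both
          -- estimates.
          trans (N-agree n k (N n ⊔ N i) N≤k (ℕ.m≤m⊔n (N n) (N i)) i (ℕ.m<n⇒m<1+n i<n))
            (trans (N-agree i (N n ⊔ N i) (N i) (ℕ.m≤n⊔m (N n) (N i)) ℕ.≤-refl i ℕ.≤-refl)
              (sym (cong-app (proj₂ limit) i)))

  A^ω-polish : {A : Set} → A ↣ ℕ → Polish (A^ω A)
  A^ω-polish enc = separable , d , d-isMetric , d-induces , complete (λ s → s , refl)
    where open SequenceMetric (A^ω-sequence enc)

  -- From analytic subsets of a subspace to Souslin sets.

  -- If h : X → T and f : P → T are continuous then {(x , p) ∣ h x ≡ f p} is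
  -- closed in X × P, hence the trace of its closure in 2^ω × P.  The point p is
  -- coded by indices of dense points of P within distance 1/1+ i of p.
  analytic-trace : (Y : Subset 2^ω) {A : Subset (Subspace 2^ω Y)} → Analytic (Subspace 2^ω Y) A →
    Σ (Pred (ℕ → Bool) 0ℓ) λ B → Souslin B × A ≐ (value ⊢ B)
  analytic-trace Y {A}
    (T , (_ , T-dist , T-metric , T-induces , _) , Y′ , h , B , (P , P-polish , f , f-continuous , B≐) , A≐) =
    (λ t → ∃[ γ ] γ ∈ F × proj₂ ∘ γ ≡ t)
    , record { G = ℕ × Bool ; encode = ×↣ℕ ℕ↣ℕ Bool↣ℕ ; π = proj₂ ; F = F ; closed = closed ; image = id , id }
    , (λ x∈A → A⊆ (proj₁ B≐ (proj₁ A≐ x∈A)))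
    , λ (γ , γ∈F , eq) → proj₂ A≐ (proj₂ B≐ (⊆A γ γ∈F eq))
    where
    X = Subspace 2^ω Y

    X-sequence : SequenceSpace X
    X-sequence = Subspace-sequence Y (A^ω-sequence Bool↣ℕ)

    D           = proj₁ (proj₁ P-polish)
    D-countable = proj₁ (proj₂ (proj₁ P-polish))
    D-dense     = proj₂ (proj₂ (proj₁ P-polish))
    d           = proj₁ (proj₂ P-polish)
    d-isMetric  = proj₁ (proj₂ (proj₂ P-polish))
    d-induces   = proj₁ (proj₂ (proj₂ (proj₂ P-polish)))
    d-complete  = proj₂ (proj₂ (proj₂ (proj₂ P-polish)))
    index       = proj₁ D-countable

    open Metric d-isMetric

    H : Carrier X → Carrier T
    H x = value (_≅_.to h x)

    Near : ℕ → ℕ → Pred (Carrier P) 0ℓ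
    Near i k p = ∃[ q ] q ∈ D × index q ≡ k × Ball d q (fromℚ (1/1+ i)) p

    Approximation : (ℕ → ℕ × Bool) → ℕ → Carrier X → Carrier P → Set
    Approximation γ n x p =
      H x ≡ f p × Agree n (proj₂ ∘ γ) (value x) × (∀ i → i < n → Near i (proj₁ (γ i)) p)

    F : Pred (ℕ → ℕ × Bool) 0ℓ
    F γ = ∀ n → ∃[ x ] ∃[ p ] Approximation γ n x p

    closed : ∀ γ → (∀ n → ∃[ δ ] δ ∈ F × Agree n γ δ) → γ ∈ F
    closed γ approx n =
      let δ , δ∈F , γ≈δ = approx n
          x , p , eq , δ≈x , near = δ∈F n
      in x , p , eq , Agree-trans (Agree-cong proj₂ γ≈δ) δ≈x
       , λ i i<n → subst (λ g → Near i (proj₁ g) p) (sym (γ≈δ i i<n)) (near i i<n)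

    A⊆ : ∀ {x} → (∃[ p ] f p ≡ H x) → ∃[ γ ] γ ∈ F × proj₂ ∘ γ ≡ value x
    A⊆ {x} (p , fp≡Hx) = (λ i → index (proj₁ (near i)) , value x i)
      , (λ n → x , p , sym fp≡Hx , (λ _ _ → refl) , λ i _ →
           let q , q∈D , b = near i in q , q∈D , refl , Ball-sym {ε = fromℚ (1/1+ i)} b)
      , refl
      where
      near : ∀ i → ∃[ q ] q ∈ D × Ball d p (fromℚ (1/1+ i)) q
      near i = D-dense _ (Induced.Ball-open {X = P} d-isMetric d-induces p (1/1+ i))
        (p , Ball-refl {ε = fromℚ (1/1+ i)} (0<fromℚ (1/1+-positive i)))

    -- The points `ps n` converge to some `p`. If `f p` and `H x` were distinct, disjoint balls
    -- around them would both contain `H (xs k)`, which equals `f (ps k)`, for large `k`.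
    ⊆A : ∀ {x} γ → γ ∈ F → proj₂ ∘ γ ≡ value x → ∃[ p ] f p ≡ H x
    ⊆A {x} γ γ∈F γ≡x = p , dne λ fp≢Hx →
      let r , 0<r , disjoint = Metric.Ball-disjoint T-metric (fp≢Hx ∘ sym)
          n , near-x = SequenceSpace.open⇒ X-sequence
            (_≅_.to-continuous h _ (_ , Induced.Ball-open {X = T} T-metric T-induces (H x) r , id , id))
            x (Metric.Ball-refl T-metric {ε = fromℚ r} (0<fromℚ 0<r))
          ε , 0<ε , near-p = Equivalence.to (d-induces _)
            (f-continuous _ (Induced.Ball-open {X = T} T-metric T-induces (f p) r))
            p (Metric.Ball-refl T-metric {ε = fromℚ r} (0<fromℚ 0<r))
          N , close = limit ε 0<ε
          k = n ⊔ N
      in disjoint (H (xs k))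
           (near-x (xs k) (Agree-≤ (ℕ.m≤m⊔n n N) (xs-agree k)))
           (subst (Ball T-dist (f p) (fromℚ r)) (sym (xs≡ps k))
             (near-p {ps k} (Ball-sym {ε = ε} (close k (ℕ.m≤n⊔m n N)))))
      where
      xs : ℕ → Carrier X
      xs n = proj₁ (γ∈F n)

      ps : ℕ → Carrier P
      ps n = proj₁ (proj₂ (γ∈F n))

      xs≡ps : ∀ n → H (xs n) ≡ f (ps n)
      xs≡ps n = proj₁ (proj₂ (proj₂ (γ∈F n)))

      xs-agree : ∀ n → Agree n (value x) (value (xs n))
      xs-agree n = subst (λ t → Agree n t (value (xs n))) γ≡x (proj₁ (proj₂ (proj₂ (proj₂ (γ∈F n)))))

      ps-near : ∀ n i → i < n → Near i (proj₁ (γ i)) (ps n)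
      ps-near n = proj₂ (proj₂ (proj₂ (proj₂ (γ∈F n))))

      cauchy : Cauchy d ps
      cauchy ε 0<ε =
        let q , 0<q , q∈ε = positive-rational ε 0<ε
            r , 0<r , r+r≡q = halve q 0<q
            i , i≤r = archimedean r 0<r
        in suc i , λ m n i<m i<n →
          let a , a∈D , a≡ , am = ps-near m i i<m
              b , b∈D , b≡ , bn = ps-near n i i<n
              -- Both have index `proj₁ (γ i)`, so one dense point is near `ps m` and `ps n` alike.
              a≡b = proj₂ D-countable a∈D b∈D (trans a≡ (sym b≡))
          in Ball-⊆ {ps m} {ps n} {ε} {1/1+ i ℚ.+ 1/1+ i}
               (≤-lower ε (subst (1/1+ i ℚ.+ 1/1+ i ℚ.≤_) r+r≡q (ℚ.+-mono-≤ i≤r i≤r)) q∈ε)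
               (Ball-trans {ps m} {a} {ps n} (Ball-sym {ε = fromℚ (1/1+ i)} am)
                  (subst (λ c → Ball d c (fromℚ (1/1+ i)) (ps n)) (sym a≡b) bn))

      p = proj₁ (d-complete ps cauchy)

      limit : Converges d ps p
      limit = proj₂ (d-complete ps cauchy)

  Cantor-uncountable : (f : (ℕ → Bool) → ℕ) → (∀ {x y} → f x ≡ f y → x ≡ y) → ⊥
  Cantor-uncountable f inj = Bool.not-¬ refl (cong-app (g∘f x) (f x))
    where
    g : ℕ → ℕ → Bool
    g n with em {P = ∃[ x ] f x ≡ n}
    ... | yes (x , _) = x
    ... | no _        = λ _ → false

    g∘f : ∀ x → g (f x) ≡ x
    g∘f x with em {P = ∃[ y ] f y ≡ f x}
    ... | yes (y , eq) = inj eq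
    ... | no none      = contradiction (x , refl) none

    x : ℕ → Bool
    x n = not (g n n)

  -- The space and its analytic subsets.

  Points : Subset 2^ω
  Points = IllFounded ∪ Selector

  X : Space
  X = Subspace 2^ω Points

  X-sequence : SequenceSpace X
  X-sequence = Subspace-sequence Points (A^ω-sequence Bool↣ℕ)

  -- Refinements store membership irrelevantly; deciding it recovers a usable proof.
  member : {S : Set} {Y : S → Set} (x : Refinement S Y) → Y (value x)
  member (x , [ p ]) = recompute em p

  copy-of-2^ω : {A : Subset X} {B : Pred (ℕ → Bool) 0ℓ} → Souslin B → ¬ Countable B →
    (∀ {t} → t ∈ B → t ∈ Points) → (∀ {x} → value x ∈ B → x ∈ A) → ContainsCopyOf2^ω X A
  copy-of-2^ω {A} souslin uncountable B⊆Points B⊆A =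
    (λ x → ∃[ z ] ψ z ≡ x) , (λ { (z , refl) → B⊆A (φ∈B z) }) , record
      { bijection       = mk↔ₛ′ to from to∘from from∘to
      ; to-continuous   = λ V oV → open⇐ K-sequence λ k k∈V →
          let n , p = open⇒ 2^ω-sequence oV (to k) k∈V
          -- The omitted length is `height (node (to k) n)`, as `φ-open` demands.
          in _ , λ l k≈l → p (to l) (φ-open n
               (subst₂ (Agree _) (sym (φ-to k)) (sym (φ-to l)) k≈l))
      ; from-continuous = λ V oV → open⇐ 2^ω-sequence λ z z∈V →
          let n , p = open⇒ K-sequence oV (from z) z∈V
          in n , λ w z≈w → p (from w) (φ-continuous n z≈w)
      }
    where
    open PerfectSet souslin uncountable
    open SequenceSpace

    ψ : (ℕ → Bool) → Carrier X
    ψ z = φ z , [ B⊆Points (φ∈B z) ]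

    K : Subset X
    K x = ∃[ z ] ψ z ≡ x

    K-sequence   = Subspace-sequence K X-sequence
    2^ω-sequence = A^ω-sequence Bool↣ℕ

    to : Carrier (Subspace X K) → ℕ → Bool
    to k = proj₁ (member k)

    from : (ℕ → Bool) → Carrier (Subspace X K)
    from z = ψ z , [ (z , refl) ]

    φ-to : ∀ k → φ (to k) ≡ value (value k)
    φ-to k = cong value (proj₂ (member k))

    to∘from : ∀ z → to (from z) ≡ z
    to∘from z = ext λ n → φ-open {to (from z)} {z} (suc n) (λ i _ → cong-app (φ-to (from z)) i) n ℕ.≤-refl

    from∘to : ∀ k → from (to k) ≡ k
    from∘to k = value-injective (proj₂ (member k))

  Countable-trace : {B : Pred (ℕ → Bool) 0ℓ} → Souslin B → Countable (B ∩ IllFounded) →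
    {A : Subset X} → A ⊆ (value ⊢ B) → Countable A
  Countable-trace {B} souslin c {A} A⊆B = Countable-⊆ cover (Countable-⊢ value-injective
    (Countable-∪ c (Boundedness.selector-countable (Souslin-avoiding c souslin) disjoint)))
    where
    B′ : Pred (ℕ → Bool) 0ℓ
    B′ t = t ∈ B × ∃ (Avoids c t)

    disjoint : ∀ {t} → t ∈ B′ → t ∉ IllFounded
    disjoint {t} (t∈B , β , avoids) ill = avoids (proj₁ c t) t (t∈B , ill) refl refl

    select : ∀ t → t ∈ Points → t ∉ IllFounded → t ∈ Selector
    select t (inj₁ ill) ¬ill = contradiction ill ¬ill
    select t (inj₂ s)   _    = s

    cover : A ⊆ (value ⊢ ((B ∩ IllFounded) ∪ (Selector ∩ B′)))
    cover {x} x∈A = split em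
      where
      split : Dec (value x ∈ IllFounded) → value x ∈ (B ∩ IllFounded) ∪ (Selector ∩ B′)
      split (yes ill) = inj₁ (A⊆B x∈A , ill)
      split (no ¬ill) = inj₂ (select (value x) (member x) ¬ill
                             , A⊆B x∈A , avoid c (value x) (¬ill ∘ proj₂))

  analytic-dichotomy : (A : Subset X) → Analytic X A → Countable A ⊎ ContainsCopyOf2^ω X A
  analytic-dichotomy A analytic = dichotomy (analytic-trace Points analytic) em
    where
    dichotomy : ((B , _) : Σ (Pred (ℕ → Bool) 0ℓ) λ B → Souslin B × A ≐ (value ⊢ B)) →
      Dec (Countable (B ∩ IllFounded)) → Countable A ⊎ ContainsCopyOf2^ω X A
    dichotomy (B , souslin , A⊆B , B⊆A) (yes c)          = inj₁ (Countable-trace souslin c A⊆B)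
    -- `B` may leave `Points`, but `B ∩ IllFounded` does not, so the copy found in `2^ω` lies in
    -- `X`.
    dichotomy (B , souslin , A⊆B , B⊆A) (no uncountable) = inj₂
      (copy-of-2^ω (Souslin-∩-IllFounded souslin) uncountable (inj₁ ∘ proj₂) (B⊆A ∘ proj₁))

  -- The uncountable coanalytic set.

  -- On `Points` this amounts to membership in `Selector`; as a complement, its coanalyticity
  -- reduces to analyticity of `IllFounded`.
  C : Subset X
  C x = value x ∉ IllFounded

  -- Adding the branch β to the tree t maps ω^ω × 2^ω continuously onto IllFounded.
  plant : (ℕ → ℕ × Bool) → ℕ → Bool
  plant p m = proj₂ (p m) ∨
    does (m ℕ.≟ code (applyDownFrom (proj₁ ∘ p) (length (decode m))))

  plant-branch : ∀ p n → plant p (code (applyDownFrom (proj₁ ∘ p) n)) ≡ true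
  plant-branch p n = trans (cong (proj₂ (p c) ∨_) (dec-true (c ℕ.≟ _)
      (cong (code ∘ applyDownFrom (proj₁ ∘ p)) (sym length≡n)))) (Bool.∨-zeroʳ (proj₂ (p c)))
    where
    c = code (applyDownFrom (proj₁ ∘ p) n)
    length≡n : length (decode c) ≡ n
    length≡n = trans (cong length (decode-code _)) (List.length-applyDownFrom (proj₁ ∘ p) n)

  -- Planting a branch that `t` already has leaves `t` unchanged.
  plant-onto : ∀ t → t ∈ IllFounded → ∃[ p ] plant p ≡ t
  plant-onto t (β , branch) = (λ m → β m , t m) , ext λ m →
      absorb m (m ℕ.≟ code (applyDownFrom β (length (decode m))))
    where
    absorb : ∀ m → (m? : Dec (m ≡ code (applyDownFrom β (length (decode m))))) →
      t m ∨ does m? ≡ t m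
    absorb m (no _)   = Bool.∨-identityʳ (t m)
    absorb m (yes eq) = trans (Bool.∨-zeroʳ (t m)) (sym (trans (cong t eq) (branch _)))

  plant-continuous : Continuous (A^ω (ℕ × Bool)) 2^ω plant
  plant-continuous V oV = open⇐ (A^ω-sequence (×↣ℕ ℕ↣ℕ Bool↣ℕ)) λ p p∈V →
    let n , q = open⇒ (A^ω-sequence Bool↣ℕ) oV (plant p) p∈V
        m , r = agree-by-coordinates plant (local p) n
    in m , λ p′ p≈p′ → q (plant p′) (r p′ p≈p′)
    where
    open SequenceSpace
    local : ∀ p i → ∃[ m ] ∀ p′ → Agree m p p′ → plant p i ≡ plant p′ i
    -- Bit `i` depends on letter `i` and on as much of the branch as the sequence coded by `i` is
    -- long.
    local p i = suc i ⊔ length (decode i) , λ p′ p≈p′ →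
      cong₂ (λ g σ → proj₂ g ∨ does (i ℕ.≟ code σ))
        (p≈p′ i (ℕ.m≤m⊔n (suc i) (length (decode i))))
        (prefix-cong (Agree-cong proj₁ (Agree-≤ (ℕ.m≤n⊔m (suc i) (length (decode i))) p≈p′)))

  C-coanalytic : Coanalytic X C
  C-coanalytic = 2^ω , A^ω-polish Bool↣ℕ , Points
    , record { bijection = mk↔ₛ′ id id (λ _ → refl) (λ _ → refl)
             ; to-continuous = λ _ oV → oV ; from-continuous = λ _ oV → oV }
    , ∁ IllFounded
    , (A^ω (ℕ × Bool) , A^ω-polish (×↣ℕ ℕ↣ℕ Bool↣ℕ) , plant , plant-continuous
      -- `Π¹₁` of a complement asks for the double complement, hence `dne`.
      , (λ {t} ¬¬ill → plant-onto t (dne ¬¬ill))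
      , λ { (p , refl) ¬ill → ¬ill (proj₁ ∘ p , plant-branch p) })
    , id , id

  C-uncountable : ¬ Countable C
  C-uncountable (f , inj) = Ord-uncountable (f ∘ point)
    λ {a} {b} eq → tree-canonical-reflects-≃
      (cong value (inj (tree-wellFounded (canonical a)) (tree-wellFounded (canonical b)) eq))
    where
    point : Ord → Carrier X
    point a = tree (canonical a) , [ inj₂ (a , refl) ]

  C-thin : ¬ ContainsCopyOf2^ω X C
  C-thin (K , K⊆C , K≅2^ω) = Cantor-uncountable (f ∘ g) λ {x} {y} eq →
      g-injective (f-injective (g-select x , x , refl) (g-select y , y , refl) eq)
    where
    open SequenceSpace
    open _≅_ K≅2^ω using (from; from-continuous; bijection)

    g : (ℕ → Bool) → (ℕ → Bool)
    g x = value (value (from x))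

    g-injective : ∀ {x y} → g x ≡ g y → x ≡ y
    g-injective {x} {y} eq =
      trans (sym (Inverse.strictlyInverseˡ bijection x))
        (trans (cong (Inverse.to bijection) (value-injective (value-injective eq)))
          (Inverse.strictlyInverseˡ bijection y))

    g-disjoint : ∀ x → g x ∉ IllFounded
    g-disjoint x = K⊆C (member (from x))

    g-select : ∀ x → g x ∈ Selector
    g-select x = [ (λ ill → contradiction ill (g-disjoint x)) , id ]′ (member (value (from x)))

    g-local : ∀ x i → ∃[ m ] ∀ y → Agree m x y → g x i ≡ g y i
    g-local x i = open⇒ (A^ω-sequence Bool↣ℕ)
      (from-continuous (λ k → g x i ≡ value (value k) i)
        (open⇐ (Subspace-sequence K X-sequence) λ k eq → suc i , λ l k≈l →
          trans eq (k≈l i ℕ.≤-refl)))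
      x refl

    -- A code pairs the bits of `x` with those of `g x`; the graph of the continuous map `g` is
    -- closed.
    range-souslin : Souslin (λ t → ∃[ x ] g x ≡ t)
    range-souslin = record
      { G      = Bool × Bool
      ; encode = ×↣ℕ Bool↣ℕ Bool↣ℕ
      ; π      = proj₂
      ; F      = λ γ → g (proj₁ ∘ γ) ≡ proj₂ ∘ γ
      ; closed = λ γ approx → ext λ i →
          let m , local = g-local (proj₁ ∘ γ) i
              δ , gδ≡ , γ≈δ = approx (m ⊔ suc i)
          in trans (local (proj₁ ∘ δ) (Agree-cong proj₁ (Agree-≤ (ℕ.m≤m⊔n m (suc i)) γ≈δ)))
               (trans (cong-app gδ≡ i) (sym (cong proj₂ (γ≈δ i (ℕ.m≤n⊔m m (suc i))))))
      ; image  = (λ { (x , refl) → (λ n → x n , g x n) , refl , refl })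
               , λ { (γ , gγ≡ , refl) → proj₁ ∘ γ , gγ≡ }
      }

    countable : Countable (Selector ∩ (λ t → ∃[ x ] g x ≡ t))
    countable = Boundedness.selector-countable range-souslin λ { (x , refl) → g-disjoint x }

    f = proj₁ countable

    f-injective : ∀ {t u} → t ∈ Selector ∩ (λ t → ∃[ x ] g x ≡ t) →
      u ∈ Selector ∩ (λ t → ∃[ x ] g x ≡ t) → f t ≡ f u → t ≡ u
    f-injective = proj₂ countable

proposition23 : (∀ {ℓ} → ExcludedMiddle ℓ) →
    (∀ {a b} → Extensionality a b) →
    Σ Space λ X →
    Separable X × Metrizable X ×
    (∀ (A : Subset X) → Analytic X A → Countable A ⊎ ContainsCopyOf2^ω X A) ×
    (Σ (Subset X) λ C →
    Coanalytic X C × (¬ Countable C) × (¬ ContainsCopyOf2^ω X C))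
proposition23 em ext =
  X , separable , metrizable , analytic-dichotomy , C , C-coanalytic , C-uncountable , C-thin
  where
  open Classical em ext
  open SequenceMetric X-sequence using (separable; metrizable)
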